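{- Let $k$ be a positive integer, let $\mathcal{A}$ be a monotone family of subsets of $[n]$ with all minterms of size at most $k$, and let $p\in[0,1]$ with $kp\le 1$. If $\mathbb{E}^*_p(\mathcal{A})=1$, then $\mu_{kp}(\mathcal{A})>1/e$.
   Context: Let $[n]=\{0,1,\ldots,n\}$ and let $P([n])$ be its power set. For $p\in[0,1]$, $\mu_p(\mathcal{A})$ is the probability that a random subset of $[n]$, containing each element independently with probability $p$, belongs to $\mathcal{A}\subseteq P([n])$. A family $\mathcal{A}$ is monotone if $A\in\mathcal{A}$ and $A\subset B\subseteq [n]$ imply $B\in\mathcal{A}$. A minterm of $\mathcal{A}$ is a member of $\mathcal{A}$ minimal with respect to inclusion; let $\mathcal{M}$ be the set of minterms of $\mathcal{A}$. The fractional expectation of $\mathcal{A}$ with respect to $\mu_p$ is $$\mathbb{E}^*_p(\mathcal{A})=\min \sum_{B\subseteq[n]}\beta(B)\,p^{|B|},$$ where the minimum is over all functions $\beta:P([n])\to\mathbb{R}^{\ge 0}$ such that $\sum_{B\subseteq A}\beta(B)\ge 1$ for all $A\in\mathcal{M}$. (The empty set is allowed as $B$; $p^0=1$.) -}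

module Defs where

open import Algebra.Bundles using (RawRing)
import Algebra.Definitions.RawSemiring as RawSemiringDefinitions
open import Data.Bool.Base using (if_then_else_)
open import Data.Fin.Subset using (Subset; inside; outside; ∣_∣; _⊆_)
open import Data.Fin.Subset.Properties using (_⊆?_)
open import Data.Integer.Base as ℤ using (+_; +0; +[1+_]; -[1+_])
import Data.Integer.Properties as ℤ
open import Data.Nat.Base as ℕ using (ℕ; zero; suc; _!)
import Data.Nat.Properties as ℕ
open import Data.Nat.Solver using () renaming (module +-*-Solver to ℕ-Solver)
open import Data.Product.Base using (∃-syntax; _×_; _,_; proj₁; proj₂)
open import Data.Rational.Base as ℚ using (ℚ; mkℚ; 0ℚ; 1ℚ; ½)
import Data.Rational.Properties as ℚ
open import Data.Rational.Solver using (module +-*-Solver)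
import Data.Rational.Unnormalised.Base as ℚᵘ
import Data.Rational.Unnormalised.Properties as ℚᵘ
open import Data.Sum.Base using (inj₁; inj₂)
open import Data.Vec.Base using ([]; _∷_)
open import Function.Base using (_∘_)
open import Level using (Level; 0ℓ)
open import Relation.Binary.PropositionalEquality
  using (_≡_; refl; sym; trans; cong; cong₂; subst; subst₂; module ≡-Reasoning)
open import Relation.Nullary.Decidable.Core using (does)
open import Relation.Unary using (Pred; Decidable)

------------------------------------------------------------------------
-- Real numbers
--
-- The standard library has no real numbers.  A real is represented by a
-- Cauchy sequence of rationals, two sequences being identified (_≃_)
-- when their difference tends to 0.  All operations act termwise.  The
-- proofs that the results are Cauchy are abstract, since normalising
-- them is expensive; the sequences themselves compute.

Eventually : Pred ℕ 0ℓ → Set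
Eventually P = ∃[ N ] (∀ n → N ℕ.≤ n → P n)

IsCauchy : (ℕ → ℚ) → Set
IsCauchy s = ∀ ε → 0ℚ ℚ.< ε →
  ∃[ N ] (∀ m n → N ℕ.≤ m → N ℕ.≤ n → ℚ.∣ s m ℚ.- s n ∣ ℚ.< ε)

record ℝ : Set where
  constructor mkℝ
  field
    seq      : ℕ → ℚ
    isCauchy : IsCauchy seq

open ℝ public

infix 4 _≃_ _≤_ _<_

_≃_ : ℝ → ℝ → Set
x ≃ y = ∀ ε → 0ℚ ℚ.< ε → Eventually λ n → ℚ.∣ seq x n ℚ.- seq y n ∣ ℚ.< ε

_≤_ : ℝ → ℝ → Set
x ≤ y = ∀ ε → 0ℚ ℚ.< ε → Eventually λ n → seq x n ℚ.≤ seq y n ℚ.+ ε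

_<_ : ℝ → ℝ → Set
x < y = ∃[ ε ] (0ℚ ℚ.< ε × Eventually λ n → seq x n ℚ.+ ε ℚ.≤ seq y n)

private
  *-pos : ∀ {p q} → 0ℚ ℚ.< p → 0ℚ ℚ.< q → 0ℚ ℚ.< p ℚ.* q
  *-pos {p} {q} 0<p 0<q = subst (ℚ._< p ℚ.* q) (ℚ.*-zeroʳ p)
    (ℚ.*-monoʳ-<-pos p {{ℚ.positive 0<p}} 0<q)

  0<½ : 0ℚ ℚ.< ½
  0<½ = ℚ.positive⁻¹ ½

  0<1 : 0ℚ ℚ.< 1ℚ
  0<1 = ℚ.positive⁻¹ 1ℚ

  half+half : ∀ ε → ½ ℚ.* ε ℚ.+ ½ ℚ.* ε ≡ ε
  half+half ε = trans (sym (ℚ.*-distribʳ-+ ε ½ ½)) (ℚ.*-identityˡ ε)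

  *-mono-≤-0 : ∀ {a b c d} → 0ℚ ℚ.≤ a → 0ℚ ℚ.≤ d → a ℚ.≤ b → c ℚ.≤ d →
    a ℚ.* c ℚ.≤ b ℚ.* d
  *-mono-≤-0 {a} {b} {c} {d} 0≤a 0≤d a≤b c≤d = ℚ.≤-trans
    (ℚ.*-monoˡ-≤-nonNeg a {{ℚ.nonNegative 0≤a}} c≤d)
    (ℚ.*-monoʳ-≤-nonNeg d {{ℚ.nonNegative 0≤d}} a≤b)

  *-mono-≤-< : ∀ {a b p d} → 0ℚ ℚ.< b → a ℚ.≤ b → ℚ.∣ p ∣ ℚ.< d →
    a ℚ.* ℚ.∣ p ∣ ℚ.< b ℚ.* d
  *-mono-≤-< {b = b} {p} 0<b a≤b ∣p∣<d = ℚ.≤-<-trans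
    (ℚ.*-monoʳ-≤-nonNeg ℚ.∣ p ∣ {{ℚ.∣-∣-nonNeg p}} a≤b)
    (ℚ.*-monoʳ-<-pos b {{ℚ.positive 0<b}} ∣p∣<d)

  eventually-bounded : (x : ℝ) → ∃[ K ] (0ℚ ℚ.< K ×
    Eventually λ n → ℚ.∣ seq x n ∣ ℚ.≤ K)
  eventually-bounded x with isCauchy x 1ℚ 0<1
  ... | N , close = K , 0<K , N , bound
    where
    K = ℚ.∣ seq x N ∣ ℚ.+ 1ℚ

    0<K : 0ℚ ℚ.< K
    0<K = subst (ℚ._< K) (ℚ.+-identityˡ 0ℚ)
      (ℚ.+-mono-≤-< (ℚ.0≤∣p∣ (seq x N)) 0<1)

    bound : ∀ n → N ℕ.≤ n → ℚ.∣ seq x n ∣ ℚ.≤ K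
    bound n N≤n = subst (λ z → ℚ.∣ z ∣ ℚ.≤ K) lem
      (ℚ.≤-trans (ℚ.∣p+q∣≤∣p∣+∣q∣ (seq x N) (seq x n ℚ.- seq x N))
        (ℚ.+-monoʳ-≤ ℚ.∣ seq x N ∣ (ℚ.<⇒≤ (close n N N≤n ℕ.≤-refl))))
      where
      lem : seq x N ℚ.+ (seq x n ℚ.- seq x N) ≡ seq x n
      lem = solve 2 (λ a b → a :+ (b :- a) := b) refl (seq x N) (seq x n)
        where open +-*-Solver

  rescale : ∀ K → 0ℚ ℚ.< K → ∀ ε → 0ℚ ℚ.< ε →
    ∃[ δ ] (0ℚ ℚ.< δ × K ℚ.* δ ≡ ε)
  rescale K 0<K ε 0<ε = 1/K ℚ.* ε , *-pos 0<1/K 0<ε ,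
    trans (sym (ℚ.*-assoc K 1/K ε))
      (trans (cong (ℚ._* ε) (ℚ.*-inverseʳ K)) (ℚ.*-identityˡ ε))
    where
    instance
      K>0 : ℚ.Positive K
      K>0 = ℚ.positive 0<K
      K≢0 : ℚ.NonZero K
      K≢0 = ℚ.pos⇒nonZero K
    1/K = ℚ.1/ K
    0<1/K : 0ℚ ℚ.< 1/K
    0<1/K = ℚ.positive⁻¹ 1/K {{ℚ.1/pos⇒pos K}}

private abstract
  constant-cauchy : ∀ q → IsCauchy (λ _ → q)
  constant-cauchy q ε 0<ε = 0 , λ _ _ _ _ →
    subst (λ z → ℚ.∣ z ∣ ℚ.< ε) (sym (ℚ.+-inverseʳ q)) 0<ε

fromℚ : ℚ → ℝ
fromℚ q = mkℝ (λ _ → q) (constant-cauchy q)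

fromℕ : ℕ → ℝ
fromℕ n = fromℚ (+ n ℚ./ 1)

0ℝ 1ℝ : ℝ
0ℝ = fromℚ 0ℚ
1ℝ = fromℚ 1ℚ

private
  product-close : ∀ {K L δ η} a b c d → 0ℚ ℚ.< K → 0ℚ ℚ.< L →
    ℚ.∣ a ∣ ℚ.≤ K → ℚ.∣ d ∣ ℚ.≤ L → ℚ.∣ c ℚ.- d ∣ ℚ.< δ → ℚ.∣ a ℚ.- b ∣ ℚ.< η →
    ℚ.∣ a ℚ.* c ℚ.- b ℚ.* d ∣ ℚ.< K ℚ.* δ ℚ.+ L ℚ.* η
  product-close {K} {L} {δ} {η} a b c d 0<K 0<L ∣a∣≤K ∣d∣≤L f g = begin-strict
    ℚ.∣ a ℚ.* c ℚ.- b ℚ.* d ∣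
      ≡⟨ cong ℚ.∣_∣ (lem a b c d) ⟨
    ℚ.∣ a ℚ.* (c ℚ.- d) ℚ.+ d ℚ.* (a ℚ.- b) ∣
      ≤⟨ ℚ.∣p+q∣≤∣p∣+∣q∣ (a ℚ.* (c ℚ.- d)) (d ℚ.* (a ℚ.- b)) ⟩
    ℚ.∣ a ℚ.* (c ℚ.- d) ∣ ℚ.+ ℚ.∣ d ℚ.* (a ℚ.- b) ∣
      ≡⟨ cong₂ ℚ._+_ (ℚ.∣p*q∣≡∣p∣*∣q∣ a (c ℚ.- d)) (ℚ.∣p*q∣≡∣p∣*∣q∣ d (a ℚ.- b)) ⟩
    ℚ.∣ a ∣ ℚ.* ℚ.∣ c ℚ.- d ∣ ℚ.+ ℚ.∣ d ∣ ℚ.* ℚ.∣ a ℚ.- b ∣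
      <⟨ ℚ.+-mono-< (*-mono-≤-< {p = c ℚ.- d} 0<K ∣a∣≤K f)
                    (*-mono-≤-< {p = a ℚ.- b} 0<L ∣d∣≤L g) ⟩
    K ℚ.* δ ℚ.+ L ℚ.* η ∎
    where
    open ℚ.≤-Reasoning
    lem : ∀ a b c d →
      a ℚ.* (c ℚ.- d) ℚ.+ d ℚ.* (a ℚ.- b) ≡ a ℚ.* c ℚ.- b ℚ.* d
    lem = solve 4 (λ a b c d →
      a :* (c :- d) :+ d :* (a :- b) := a :* c :- b :* d) refl
      where open +-*-Solver

private abstract
  +-cauchy : (x y : ℝ) → IsCauchy (λ n → seq x n ℚ.+ seq y n)
  +-cauchy x y ε 0<ε with isCauchy x (½ ℚ.* ε) (*-pos 0<½ 0<ε)
                  | isCauchy y (½ ℚ.* ε) (*-pos 0<½ 0<ε)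
  ... | M , f | N , g = M ℕ.⊔ N , λ m n le₁ le₂ →
    subst₂ (λ u v → ℚ.∣ u ∣ ℚ.< v)
      (lem (seq x m) (seq x n) (seq y m) (seq y n)) (half+half ε)
      (ℚ.≤-<-trans
        (ℚ.∣p+q∣≤∣p∣+∣q∣ (seq x m ℚ.- seq x n) (seq y m ℚ.- seq y n))
        (ℚ.+-mono-< (f m n (ℕ.m⊔n≤o⇒m≤o M N le₁) (ℕ.m⊔n≤o⇒m≤o M N le₂))
                    (g m n (ℕ.m⊔n≤o⇒n≤o M N le₁) (ℕ.m⊔n≤o⇒n≤o M N le₂))))
    where
    lem : ∀ a b c d → (a ℚ.- b) ℚ.+ (c ℚ.- d) ≡ (a ℚ.+ c) ℚ.- (b ℚ.+ d)
    lem = solve 4 (λ a b c d → (a :- b) :+ (c :- d) := (a :+ c) :- (b :+ d)) refl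
      where open +-*-Solver

  neg-cauchy : (x : ℝ) → IsCauchy (λ n → ℚ.- seq x n)
  neg-cauchy x ε 0<ε =
    let N , f = isCauchy x ε 0<ε in N , λ m n N≤m N≤n →
      subst (λ z → ℚ.∣ z ∣ ℚ.< ε) (lem (seq x n) (seq x m)) (f n m N≤n N≤m)
    where
    lem : ∀ a b → a ℚ.- b ≡ (ℚ.- b) ℚ.- (ℚ.- a)
    lem = solve 2 (λ a b → a :- b := (:- b) :- (:- a)) refl
      where open +-*-Solver

  *-cauchy : (x y : ℝ) → IsCauchy (λ n → seq x n ℚ.* seq y n)
  *-cauchy x y ε 0<ε = bounds (eventually-bounded x) (eventually-bounded y)
    where
    Goal : Set
    Goal = ∃[ N ] (∀ m n → N ℕ.≤ m → N ℕ.≤ n →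
      ℚ.∣ seq x m ℚ.* seq y m ℚ.- seq x n ℚ.* seq y n ∣ ℚ.< ε)

    0<ε/2 : 0ℚ ℚ.< ½ ℚ.* ε
    0<ε/2 = *-pos 0<½ 0<ε

    EventuallyBounded : ℝ → Set
    EventuallyBounded z = ∃[ K ] (0ℚ ℚ.< K ×
      Eventually λ n → ℚ.∣ seq z n ∣ ℚ.≤ K)

    bounds : EventuallyBounded x → EventuallyBounded y → Goal
    bounds (K , 0<K , A , ∣x∣≤K) (L , 0<L , B , ∣y∣≤L) =
      scale (rescale K 0<K (½ ℚ.* ε) 0<ε/2) (rescale L 0<L (½ ℚ.* ε) 0<ε/2)
      where
      scale : ∃[ δ ] (0ℚ ℚ.< δ × K ℚ.* δ ≡ ½ ℚ.* ε) →
              ∃[ η ] (0ℚ ℚ.< η × L ℚ.* η ≡ ½ ℚ.* ε) → Goal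
      scale (δ , 0<δ , Kδ≡ε/2) (η , 0<η , Lη≡ε/2) =
        (A ℕ.⊔ B) ℕ.⊔ (M ℕ.⊔ N) , λ m n le₁ le₂ →
          subst (ℚ.∣ seq x m ℚ.* seq y m ℚ.- seq x n ℚ.* seq y n ∣ ℚ.<_)
            (trans (cong₂ ℚ._+_ Kδ≡ε/2 Lη≡ε/2) (half+half ε))
            (product-close (seq x m) (seq x n) (seq y m) (seq y n) 0<K 0<L
              (∣x∣≤K m (A≤ le₁)) (∣y∣≤L n (B≤ le₂))
              (proj₂ (isCauchy y δ 0<δ) m n (M≤ le₁) (M≤ le₂))
              (proj₂ (isCauchy x η 0<η) m n (N≤ le₁) (N≤ le₂)))
        where
        M N : ℕ
        M = proj₁ (isCauchy y δ 0<δ)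
        N = proj₁ (isCauchy x η 0<η)
        module _ {n} (le : (A ℕ.⊔ B) ℕ.⊔ (M ℕ.⊔ N) ℕ.≤ n) where
          A≤ : A ℕ.≤ n
          A≤ = ℕ.m⊔n≤o⇒m≤o A B (ℕ.m⊔n≤o⇒m≤o (A ℕ.⊔ B) (M ℕ.⊔ N) le)
          B≤ : B ℕ.≤ n
          B≤ = ℕ.m⊔n≤o⇒n≤o A B (ℕ.m⊔n≤o⇒m≤o (A ℕ.⊔ B) (M ℕ.⊔ N) le)
          M≤ : M ℕ.≤ n
          M≤ = ℕ.m⊔n≤o⇒m≤o M N (ℕ.m⊔n≤o⇒n≤o (A ℕ.⊔ B) (M ℕ.⊔ N) le)
          N≤ : N ℕ.≤ n
          N≤ = ℕ.m⊔n≤o⇒n≤o M N (ℕ.m⊔n≤o⇒n≤o (A ℕ.⊔ B) (M ℕ.⊔ N) le)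

infixl 6 _+_ _-_
infixl 7 _*_
infix  8 -_

_+_ : ℝ → ℝ → ℝ
x + y = mkℝ (λ n → seq x n ℚ.+ seq y n) (+-cauchy x y)

_*_ : ℝ → ℝ → ℝ
x * y = mkℝ (λ n → seq x n ℚ.* seq y n) (*-cauchy x y)

-_ : ℝ → ℝ
- x = mkℝ (λ n → ℚ.- seq x n) (neg-cauchy x)

_-_ : ℝ → ℝ → ℝ
x - y = x + - y

+-*-rawRing : RawRing 0ℓ 0ℓ
+-*-rawRing = record
  { Carrier = ℝ ; _≈_ = _≃_ ; _+_ = _+_ ; _*_ = _*_ ; -_ = -_
  ; 0# = 0ℝ ; 1# = 1ℝ }

open RawSemiringDefinitions (RawRing.rawSemiring +-*-rawRing) public
  using (_^_)

------------------------------------------------------------------------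
-- Reciprocals of positive reals

-- Total reciprocal on ℚ.  A positive real may have finitely many terms
-- that are 0; the value chosen there does not affect the limit.
recipℚ : ℚ → ℚ
recipℚ   (mkℚ +0       _ _) = 0ℚ
recipℚ q@(mkℚ +[1+ _ ] _ _) = ℚ.1/ q
recipℚ q@(mkℚ -[1+ _ ] _ _) = ℚ.1/ q

recipℚ-inverseˡ : ∀ {q} → 0ℚ ℚ.< q → recipℚ q ℚ.* q ≡ 1ℚ
recipℚ-inverseˡ {mkℚ +0       _ _} (ℚ.*<* (ℤ.+<+ ()))
recipℚ-inverseˡ {q@(mkℚ +[1+ _ ] _ _)} _ = ℚ.*-inverseˡ q
recipℚ-inverseˡ {q@(mkℚ -[1+ _ ] _ _)} _ = ℚ.*-inverseˡ q

private
  recipℚ-pos : ∀ {q} → 0ℚ ℚ.< q → 0ℚ ℚ.< recipℚ q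
  recipℚ-pos {mkℚ +0       _ _} (ℚ.*<* (ℤ.+<+ ()))
  recipℚ-pos {q@(mkℚ +[1+ _ ] _ _)} _ = ℚ.positive⁻¹ (ℚ.1/ q)
  recipℚ-pos {mkℚ -[1+ _ ] _ _} (ℚ.*<* ())

  recipℚ-antimono : ∀ {δ q} → 0ℚ ℚ.< δ → δ ℚ.≤ q → recipℚ q ℚ.≤ recipℚ δ
  recipℚ-antimono {δ} {q} 0<δ δ≤q = begin
    recipℚ q
      ≡⟨ ℚ.*-identityʳ (recipℚ q) ⟨
    recipℚ q ℚ.* 1ℚ
      ≡⟨ cong (recipℚ q ℚ.*_) (recipℚ-inverseˡ 0<δ) ⟨
    recipℚ q ℚ.* (recipℚ δ ℚ.* δ)
      ≤⟨ ℚ.*-monoˡ-≤-nonNeg (recipℚ q)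
           {{ℚ.nonNegative (ℚ.<⇒≤ (recipℚ-pos 0<q))}}
           (ℚ.*-monoˡ-≤-nonNeg (recipℚ δ)
             {{ℚ.nonNegative (ℚ.<⇒≤ (recipℚ-pos 0<δ))}} δ≤q) ⟩
    recipℚ q ℚ.* (recipℚ δ ℚ.* q)
      ≡⟨ solve 3 (λ a b c → a :* (b :* c) := b :* (a :* c)) refl
           (recipℚ q) (recipℚ δ) q ⟩
    recipℚ δ ℚ.* (recipℚ q ℚ.* q)
      ≡⟨ cong (recipℚ δ ℚ.*_) (recipℚ-inverseˡ 0<q) ⟩
    recipℚ δ ℚ.* 1ℚ
      ≡⟨ ℚ.*-identityʳ (recipℚ δ) ⟩
    recipℚ δ ∎
    where
    open ℚ.≤-Reasoning
    open +-*-Solver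
    0<q : 0ℚ ℚ.< q
    0<q = ℚ.<-≤-trans 0<δ δ≤q

  recipℚ-diff : ∀ {p q} → 0ℚ ℚ.< p → 0ℚ ℚ.< q →
    recipℚ p ℚ.- recipℚ q ≡ (recipℚ p ℚ.* recipℚ q) ℚ.* (q ℚ.- p)
  recipℚ-diff {p} {q} 0<p 0<q = sym (begin
    (p′ ℚ.* q′) ℚ.* (q ℚ.- p)
      ≡⟨ solve 4 (λ a b c d →
           (a :* b) :* (c :- d) := a :* (b :* c) :- b :* (a :* d)) refl p′ q′ q p ⟩
    p′ ℚ.* (q′ ℚ.* q) ℚ.- q′ ℚ.* (p′ ℚ.* p)
      ≡⟨ cong₂ (λ u v → p′ ℚ.* u ℚ.- q′ ℚ.* v)
           (recipℚ-inverseˡ 0<q) (recipℚ-inverseˡ 0<p) ⟩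
    p′ ℚ.* 1ℚ ℚ.- q′ ℚ.* 1ℚ
      ≡⟨ cong₂ ℚ._-_ (ℚ.*-identityʳ p′) (ℚ.*-identityʳ q′) ⟩
    p′ ℚ.- q′ ∎)
    where
    open ≡-Reasoning
    open +-*-Solver
    p′ = recipℚ p
    q′ = recipℚ q

  recipℚ-close : ∀ {δ η p q} → 0ℚ ℚ.< δ → δ ℚ.≤ p → δ ℚ.≤ q →
    ℚ.∣ q ℚ.- p ∣ ℚ.< η →
    ℚ.∣ recipℚ p ℚ.- recipℚ q ∣ ℚ.< (recipℚ δ ℚ.* recipℚ δ) ℚ.* η
  recipℚ-close {δ} {η} {p} {q} 0<δ δ≤p δ≤q close = begin-strict
    ℚ.∣ p′ ℚ.- q′ ∣
      ≡⟨ cong ℚ.∣_∣ (recipℚ-diff 0<p 0<q) ⟩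
    ℚ.∣ (p′ ℚ.* q′) ℚ.* (q ℚ.- p) ∣
      ≡⟨ ℚ.∣p*q∣≡∣p∣*∣q∣ (p′ ℚ.* q′) (q ℚ.- p) ⟩
    ℚ.∣ p′ ℚ.* q′ ∣ ℚ.* ℚ.∣ q ℚ.- p ∣
      ≡⟨ cong (ℚ._* ℚ.∣ q ℚ.- p ∣) (ℚ.0≤p⇒∣p∣≡p (ℚ.<⇒≤ (*-pos 0<p′ 0<q′))) ⟩
    (p′ ℚ.* q′) ℚ.* ℚ.∣ q ℚ.- p ∣
      <⟨ *-mono-≤-< {p = q ℚ.- p} (*-pos 0<r 0<r)
           (*-mono-≤-0 (ℚ.<⇒≤ 0<p′) (ℚ.<⇒≤ 0<r)
             (recipℚ-antimono 0<δ δ≤p) (recipℚ-antimono 0<δ δ≤q))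
           close ⟩
    (r ℚ.* r) ℚ.* η ∎
    where
    open ℚ.≤-Reasoning
    r  = recipℚ δ
    p′ = recipℚ p
    q′ = recipℚ q
    0<p : 0ℚ ℚ.< p
    0<p = ℚ.<-≤-trans 0<δ δ≤p
    0<q : 0ℚ ℚ.< q
    0<q = ℚ.<-≤-trans 0<δ δ≤q
    0<r : 0ℚ ℚ.< r
    0<r = recipℚ-pos 0<δ
    0<p′ : 0ℚ ℚ.< p′
    0<p′ = recipℚ-pos 0<p
    0<q′ : 0ℚ ℚ.< q′
    0<q′ = recipℚ-pos 0<q

private abstract
  recipℚ-cauchy : (x : ℝ) → 0ℝ < x → IsCauchy (λ n → recipℚ (seq x n))
  recipℚ-cauchy x (δ , 0<δ , N , above) = goal
    where
    r : ℚ
    r = recipℚ δ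

    0<r : 0ℚ ℚ.< r
    0<r = recipℚ-pos 0<δ

    δ≤ : ∀ n → N ℕ.≤ n → δ ℚ.≤ seq x n
    δ≤ n N≤n = subst (ℚ._≤ seq x n) (ℚ.+-identityˡ δ) (above n N≤n)

    goal : IsCauchy (λ n → recipℚ (seq x n))
    goal ε 0<ε = scale (rescale (r ℚ.* r) (*-pos 0<r 0<r) ε 0<ε)
      where
      scale : ∃[ η ] (0ℚ ℚ.< η × (r ℚ.* r) ℚ.* η ≡ ε) →
        ∃[ K ] (∀ m n → K ℕ.≤ m → K ℕ.≤ n →
          ℚ.∣ recipℚ (seq x m) ℚ.- recipℚ (seq x n) ∣ ℚ.< ε)
      scale (η , 0<η , rrη≡ε) = M ℕ.⊔ N , λ m n le₁ le₂ →
        subst (ℚ.∣ recipℚ (seq x m) ℚ.- recipℚ (seq x n) ∣ ℚ.<_) rrη≡ε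
          (recipℚ-close 0<δ
            (δ≤ m (ℕ.m⊔n≤o⇒n≤o M N le₁)) (δ≤ n (ℕ.m⊔n≤o⇒n≤o M N le₂))
            (proj₂ (isCauchy x η 0<η) n m (ℕ.m⊔n≤o⇒m≤o M N le₂) (ℕ.m⊔n≤o⇒m≤o M N le₁)))
        where
        M : ℕ
        M = proj₁ (isCauchy x η 0<η)

reciprocal : (x : ℝ) → 0ℝ < x → ℝ
reciprocal x 0<x = mkℝ (λ n → recipℚ (seq x n)) (recipℚ-cauchy x 0<x)

reciprocal-inverseˡ : ∀ x (0<x : 0ℝ < x) → reciprocal x 0<x * x ≃ 1ℝ
reciprocal-inverseˡ x (δ , 0<δ , N , above) ε 0<ε = N , λ n N≤n →
  subst (λ z → ℚ.∣ z ℚ.- 1ℚ ∣ ℚ.< ε)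
    (sym (recipℚ-inverseˡ (ℚ.<-≤-trans 0<δ
      (subst (ℚ._≤ seq x n) (ℚ.+-identityˡ δ) (above n N≤n)))))
    0<ε

------------------------------------------------------------------------
-- Euler's number, e = ∑ 1/i!

1/_! : ℕ → ℚ
1/ n ! = (+ 1 ℚ./ (n !)) {{n ℕ.!≢0}}

-- ∑1/i! n = 1/0! + 1/1! + ⋯ + 1/n!
∑1/i! : ℕ → ℚ
∑1/i! zero    = 1/ zero !
∑1/i! (suc n) = ∑1/i! n ℚ.+ 1/ suc n !

private
  toℚᵘ-unit : ∀ d → ℚ.toℚᵘ (+ 1 ℚ./ suc d) ℚᵘ.≃ ℚᵘ.mkℚᵘ (+ 1) d
  toℚᵘ-unit d = ℚ.toℚᵘ-fromℚᵘ (ℚᵘ.mkℚᵘ (+ 1) d)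

  0≤unit : ∀ d .{{_ : ℕ.NonZero d}} → 0ℚ ℚ.≤ + 1 ℚ./ d
  0≤unit (suc d) = ℚ.<⇒≤ (ℚ.positive⁻¹ (+ 1 ℚ./ suc d) {{ℚ.normalize-pos 1 (suc d)}})

  unit-double : ∀ m n .{{_ : ℕ.NonZero m}} .{{_ : ℕ.NonZero n}} →
    2 ℕ.* m ℕ.≤ n → (+ 1 ℚ./ n) ℚ.+ (+ 1 ℚ./ n) ℚ.≤ + 1 ℚ./ m
  unit-double (suc m) (suc n) 2m≤n = ℚ.toℚᵘ-cancel-≤ (begin
    ℚ.toℚᵘ (u ℚ.+ u)
      ≃⟨ ℚ.toℚᵘ-homo-+ u u ⟩
    ℚ.toℚᵘ u ℚᵘ.+ ℚ.toℚᵘ u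
      ≃⟨ ℚᵘ.+-cong (toℚᵘ-unit n) (toℚᵘ-unit n) ⟩
    v ℚᵘ.+ v
      ≤⟨ ℚᵘ.*≤* (ℤ.+≤+ le) ⟩
    ℚᵘ.mkℚᵘ (+ 1) m
      ≃⟨ toℚᵘ-unit m ⟨
    ℚ.toℚᵘ (+ 1 ℚ./ suc m) ∎)
    where
    open ℚᵘ.≤-Reasoning
    u = + 1 ℚ./ suc n
    v = ℚᵘ.mkℚᵘ (+ 1) n
    eq : suc n ℕ.* (2 ℕ.* suc m) ≡ (1 ℕ.* suc n ℕ.+ 1 ℕ.* suc n) ℕ.* suc m
    eq = ℕ-solve 2 (λ a b → a :* (con 2 :* b) := (con 1 :* a :+ con 1 :* a) :* b)
           refl (suc n) (suc m)
      where open ℕ-Solver renaming (solve to ℕ-solve)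
    le : (1 ℕ.* suc n ℕ.+ 1 ℕ.* suc n) ℕ.* suc m ℕ.≤ 1 ℕ.* (suc n ℕ.* suc n)
    le = subst₂ ℕ._≤_ eq (sym (ℕ.*-identityˡ _)) (ℕ.*-monoʳ-≤ (suc n) 2m≤n)

  archimedean : ∀ ε → 0ℚ ℚ.< ε →
    ∃[ N ] (1 ℕ.≤ N × (∀ m .{{_ : ℕ.NonZero m}} → N ℕ.≤ m → + 1 ℚ./ m ℚ.< ε))
  archimedean (mkℚ +0       _ _) (ℚ.*<* (ℤ.+<+ ()))
  archimedean (mkℚ -[1+ _ ] _ _) (ℚ.*<* ())
  archimedean ε@(mkℚ +[1+ a ] d _) _ = 2 ℕ.+ d , ℕ.s≤s ℕ.z≤n , bound
    where
    bound : ∀ m .{{_ : ℕ.NonZero m}} → 2 ℕ.+ d ℕ.≤ m → + 1 ℚ./ m ℚ.< ε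
    bound (suc m) d<m = ℚ.toℚᵘ-cancel-< (ℚᵘ.<-respˡ-≃ (ℚᵘ.≃-sym (toℚᵘ-unit m))
      (ℚᵘ.*<* (ℤ.+<+ (subst (ℕ._< suc a ℕ.* suc m) (sym (ℕ.*-identityˡ (suc d)))
        (ℕ.≤-trans d<m (ℕ.m≤n*m (suc m) (suc a)))))))

  n≤n! : ∀ n → n ℕ.≤ n !
  n≤n! zero    = ℕ.z≤n
  n≤n! (suc n) = subst (ℕ._≤ suc n !) (ℕ.*-identityʳ (suc n))
    (ℕ.*-monoʳ-≤ (suc n) (ℕ.1≤n! n))

  increasing : ∀ (f : ℕ → ℚ) N → (∀ n → N ℕ.≤ n → f n ℚ.≤ f (suc n)) →
    ∀ {n} → N ℕ.≤′ n → f N ℚ.≤ f n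
  increasing f N step (ℕ.≤′-reflexive refl) = ℚ.≤-refl
  increasing f N step (ℕ.≤′-step {n} N≤n)   =
    ℚ.≤-trans (increasing f N step N≤n) (step n (ℕ.≤′⇒≤ N≤n))

  decreasing : ∀ (f : ℕ → ℚ) N → (∀ n → N ℕ.≤ n → f (suc n) ℚ.≤ f n) →
    ∀ {n} → N ℕ.≤′ n → f n ℚ.≤ f N
  decreasing f N step (ℕ.≤′-reflexive refl) = ℚ.≤-refl
  decreasing f N step (ℕ.≤′-step {n} N≤n)   =
    ℚ.≤-trans (step n (ℕ.≤′⇒≤ N≤n)) (decreasing f N step N≤n)

  0≤1/n! : ∀ n → 0ℚ ℚ.≤ 1/ n !
  0≤1/n! n = 0≤unit (n !) {{n ℕ.!≢0}}

  p≤p+nonneg : ∀ p {q} → 0ℚ ℚ.≤ q → p ℚ.≤ p ℚ.+ q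
  p≤p+nonneg p {q} 0≤q =
    subst (ℚ._≤ p ℚ.+ q) (ℚ.+-identityʳ p) (ℚ.+-monoʳ-≤ p 0≤q)

  ∑-step : ∀ n → ∑1/i! n ℚ.≤ ∑1/i! (suc n)
  ∑-step n = p≤p+nonneg (∑1/i! n) (0≤1/n! (suc n))

  ∑+tail-step : ∀ n → 1 ℕ.≤ n →
    ∑1/i! (suc n) ℚ.+ 1/ suc n ! ℚ.≤ ∑1/i! n ℚ.+ 1/ n !
  ∑+tail-step n 1≤n =
    subst (ℚ._≤ ∑1/i! n ℚ.+ 1/ n !)
      (sym (ℚ.+-assoc (∑1/i! n) (1/ suc n !) (1/ suc n !)))
      (ℚ.+-monoʳ-≤ (∑1/i! n)
        (unit-double (n !) (suc n !) {{n ℕ.!≢0}} {{suc n ℕ.!≢0}}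
          (ℕ.*-monoˡ-≤ (n !) (ℕ.s≤s 1≤n))))

  ∑-diff : ∀ N → 1 ℕ.≤ N → ∀ m n → N ℕ.≤ m → N ℕ.≤ n →
    ∑1/i! m ℚ.- ∑1/i! n ℚ.≤ 1/ N !
  ∑-diff N 1≤N m n N≤m N≤n = begin
    ∑1/i! m ℚ.- ∑1/i! n
      ≤⟨ ℚ.+-mono-≤ upper (ℚ.neg-antimono-≤ lower) ⟩
    (∑1/i! N ℚ.+ 1/ N !) ℚ.- ∑1/i! N
      ≡⟨ solve 2 (λ a b → (a :+ b) :- a := b) refl (∑1/i! N) (1/ N !) ⟩
    1/ N ! ∎
    where
    open ℚ.≤-Reasoning
    open +-*-Solver
    upper : ∑1/i! m ℚ.≤ ∑1/i! N ℚ.+ 1/ N !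
    upper = ℚ.≤-trans (p≤p+nonneg (∑1/i! m) (0≤1/n! m))
      (decreasing (λ k → ∑1/i! k ℚ.+ 1/ k !) N
        (λ k N≤k → ∑+tail-step k (ℕ.≤-trans 1≤N N≤k)) (ℕ.≤⇒≤′ N≤m))
    lower : ∑1/i! N ℚ.≤ ∑1/i! n
    lower = increasing ∑1/i! N (λ k _ → ∑-step k) (ℕ.≤⇒≤′ N≤n)

  ∣p-q∣≤ : ∀ p q {r} → p ℚ.- q ℚ.≤ r → q ℚ.- p ℚ.≤ r → ℚ.∣ p ℚ.- q ∣ ℚ.≤ r
  ∣p-q∣≤ p q {r} p-q≤r q-p≤r with ℚ.∣p∣≡p∨∣p∣≡-p (p ℚ.- q)
  ... | inj₁ eq = subst (ℚ._≤ r) (sym eq) p-q≤r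
  ... | inj₂ eq = subst (ℚ._≤ r) (sym (trans eq lem)) q-p≤r
    where
    lem : ℚ.- (p ℚ.- q) ≡ q ℚ.- p
    lem = solve 2 (λ a b → :- (a :- b) := b :- a) refl p q
      where open +-*-Solver

private abstract
  ∑-cauchy : IsCauchy ∑1/i!
  ∑-cauchy ε 0<ε = close (archimedean ε 0<ε)
    where
    close : ∃[ N ] (1 ℕ.≤ N × (∀ m .{{_ : ℕ.NonZero m}} → N ℕ.≤ m → + 1 ℚ./ m ℚ.< ε)) →
      ∃[ N ] (∀ m n → N ℕ.≤ m → N ℕ.≤ n → ℚ.∣ ∑1/i! m ℚ.- ∑1/i! n ∣ ℚ.< ε)
    close (N , 1≤N , small) = N , λ m n N≤m N≤n → ℚ.≤-<-trans
      (∣p-q∣≤ (∑1/i! m) (∑1/i! n)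
        (∑-diff N 1≤N m n N≤m N≤n) (∑-diff N 1≤N n m N≤n N≤m))
      1/N!<ε
      where
      1/N!<ε : 1/ N ! ℚ.< ε
      1/N!<ε = small (N !) {{N ℕ.!≢0}} (n≤n! N)

  0+1≤∑ : ∀ n → 0ℚ ℚ.+ 1ℚ ℚ.≤ ∑1/i! n
  0+1≤∑ n = subst (ℚ._≤ ∑1/i! n) (sym (ℚ.+-identityˡ 1ℚ))
    (increasing ∑1/i! 0 (λ k _ → ∑-step k) {n} (ℕ.≤⇒≤′ ℕ.z≤n))

e : ℝ
e = mkℝ ∑1/i! ∑-cauchy

0<e : 0ℝ < e
0<e = 1ℚ , 0<1 , 0 , λ n _ → 0+1≤∑ n

1/e : ℝ
1/e = reciprocal e 0<e

------------------------------------------------------------------------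
-- Families of subsets of an N-element set
--
-- A family is a predicate on Subset N.  Measuring it requires deciding
-- membership, which is classically no restriction.

private
  variable
    N : ℕ
    ℓ : Level

∑ : (Subset N → ℝ) → ℝ
∑ {zero}  f = f []
∑ {suc N} f = ∑ (f ∘ (outside ∷_)) + ∑ (f ∘ (inside ∷_))

∑[_] : {P : Pred (Subset N) ℓ} → Decidable P → (Subset N → ℝ) → ℝ
∑[ P? ] f = ∑ λ B → if does (P? B) then f B else 0ℝ

Monotone : Pred (Subset N) ℓ → Set ℓ
Monotone 𝒜 = ∀ {A B} → 𝒜 A → A ⊆ B → 𝒜 B

IsMinterm : Pred (Subset N) ℓ → Pred (Subset N) ℓ
IsMinterm 𝒜 A = 𝒜 A × (∀ {B} → 𝒜 B → B ⊆ A → B ≡ A)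

-- The probability that the random subset is exactly A.
weight : ℝ → Subset N → ℝ
weight p []            = 1ℝ
weight p (inside  ∷ A) = p * weight p A
weight p (outside ∷ A) = (1ℝ - p) * weight p A

μ : ℝ → {𝒜 : Pred (Subset N) ℓ} → Decidable 𝒜 → ℝ
μ p 𝒜? = ∑[ 𝒜? ] (weight p)

record IsFractionalCover (𝒜 : Pred (Subset N) ℓ) (β : Subset N → ℝ) : Set ℓ where
  field
    nonNegative : ∀ B → 0ℝ ≤ β B
    covers      : ∀ {A} → IsMinterm 𝒜 A → 1ℝ ≤ ∑[ _⊆? A ] β

cost : ℝ → (Subset N → ℝ) → ℝ
cost p β = ∑ λ B → β B * p ^ ∣ B ∣

-- v is the minimum (attained, not merely the infimum) defining 𝔼*ₚ(𝒜).
record Is𝔼* (p : ℝ) (𝒜 : Pred (Subset N) ℓ) (v : ℝ) : Set ℓ where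
  field
    attained   : ∃[ β ] (IsFractionalCover 𝒜 β × cost p β ≃ v)
    lowerBound : ∀ β → IsFractionalCover 𝒜 β → v ≤ cost p β

{-# OPTIONS --safe #-}
module Submission where

-- Write q = k p and, for a small member A of 𝒜, let X_A be the density with
-- respect to μ_q of the q-random set conditioned to contain A.  Every convex
-- combination X of the X_A is supported on 𝒜 and has mean 1, so that
-- μ_q(𝒜) ≥ 1 / 𝔼 X² by Cauchy–Schwarz.  Since
--   𝔼 (X_A X_B) = q ^ (- ∣ A ∩ B ∣) = ∑ { (1 / q - 1) ^ ∣ S ∣ : S ⊆ A ∩ B },
-- the function A ↦ 𝔼 (X X_A) is A ↦ ∑ { β S : S ⊆ A } for a β ≥ 0 of cost at most
-- (1 + (1 / q - 1) p) ^ k ≤ (1 + 1 / k) ^ k.  If X (nearly) minimises 𝔼 X², then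
-- 𝔼 (X X_A) ≥ 𝔼 X² (nearly) for all A, so β / 𝔼 X² is a fractional cover, and
-- 𝔼*ₚ(𝒜) = 1 forces 𝔼 X² ≤ (1 + 1 / k) ^ k < e.  This avoids linear programming
-- duality; near-minimisers are found by Frank–Wolfe descent over ℚ, with p
-- replaced by a rational p′ slightly above p and q by min (1 , k p′).

import Defs as ℝ
open import Defs using
  ( ℝ; seq; fromℚ; fromℕ; 0ℝ; 1ℝ; ∑; ∑[_]; μ; cost; weight; Monotone; IsMinterm
  ; IsFractionalCover; Is𝔼*; recipℚ; recipℚ-inverseˡ; 1/_!; ∑1/i!; 1/e)
open import Data.Bool.Base using (true; false; if_then_else_)
open import Data.Fin.Subset using (Subset; ∣_∣; Side; inside; outside; _⊆_)
open import Data.Fin.Subset.Properties using (out⊆; s⊆s; anySubset?; _⊆?_)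
open import Data.Nat.Base as ℕ using (ℕ; zero; suc; NonZero)
import Data.Nat.Properties as ℕ
open import Data.Product.Base using (∃-syntax; _×_; _,_; proj₁)
open import Data.Sum.Base using (_⊎_; inj₁; inj₂; map₁)
open import Data.Vec.Base using (Vec; []; _∷_; replicate; map)
open import Data.Vec.Relation.Unary.All using (All; []; _∷_)
open import Function.Base using (_∘_; id)
open import Level using (Level)
open import Relation.Binary.PropositionalEquality
  using (_≡_; refl; sym; trans; cong; cong₂; subst; subst₂; module ≡-Reasoning)
open import Relation.Nullary using (yes; no; contradiction)
open import Relation.Nullary.Decidable.Core using (does; _×-dec_)
open import Relation.Unary using (Pred; Decidable)

-- Ordered-field arithmetic and powers over the rationals.

module Rationals where
  open import Data.Integer.Base as ℤ using (+_; -[1+_])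
  import Data.Integer.Properties as ℤ
  open import Data.Rational.Base as ℚ hiding (NonZero; ∣_∣)
  open import Data.Rational.Properties
  open import Data.Rational.Solver using (module +-*-Solver)
  import Data.Rational.Unnormalised.Base as ℚᵘ
  import Data.Rational.Unnormalised.Properties as ℚᵘ
  open +-*-Solver using (solve; con; _:=_; _:+_; _:*_; _:-_; :-_)

  +-nonneg : ∀ {a b} → 0ℚ ≤ a → 0ℚ ≤ b → 0ℚ ≤ a + b
  +-nonneg = +-mono-≤

  *-nonneg : ∀ {a b} → 0ℚ ≤ a → 0ℚ ≤ b → 0ℚ ≤ a * b
  *-nonneg {a} {b} 0≤a 0≤b =
    subst (_≤ a * b) (*-zeroʳ a) (*-monoˡ-≤-nonNeg a {{nonNegative 0≤a}} 0≤b)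

  *-pos : ∀ {a b} → 0ℚ < a → 0ℚ < b → 0ℚ < a * b
  *-pos {a} {b} 0<a 0<b =
    subst (_< a * b) (*-zeroʳ a) (*-monoʳ-<-pos a {{positive 0<a}} 0<b)

  square-nonneg : ∀ a → 0ℚ ≤ a * a
  square-nonneg a with ≤-total 0ℚ a
  ... | inj₁ 0≤a = *-nonneg 0≤a 0≤a
  ... | inj₂ a≤0 = subst (0ℚ ≤_) (solve 1 (λ a → (:- a) :* (:- a) := a :* a) refl a)
                     (*-nonneg (neg-antimono-≤ a≤0) (neg-antimono-≤ a≤0))

  0≤1 : 0ℚ ≤ 1ℚ
  0≤1 = nonNegative⁻¹ 1ℚ

  -- Polynomial inequalities are proved below by exhibiting the difference of
  -- the two sides as a sum of nonnegative products.
  excess : ∀ {a b} d → 0ℚ ≤ d → b ≡ a + d → a ≤ b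
  excess {a} d 0≤d refl = subst (_≤ a + d) (+-identityʳ a) (+-monoʳ-≤ a 0≤d)

  p≤q⇒0≤q-p : ∀ {p q} → p ≤ q → 0ℚ ≤ q - p
  p≤q⇒0≤q-p {p} {q} p≤q = subst (_≤ q - p) (+-inverseʳ p) (+-monoˡ-≤ (- p) p≤q)

  p<q⇒0<q-p : ∀ {p q} → p < q → 0ℚ < q - p
  p<q⇒0<q-p {p} {q} p<q = subst (_< q - p) (+-inverseʳ p) (+-monoˡ-< (- p) p<q)

  *-mono-≤-nonneg : ∀ {a b c d} → 0ℚ ≤ a → 0ℚ ≤ d → a ≤ b → c ≤ d → a * c ≤ b * d
  *-mono-≤-nonneg {a} {b} {c} {d} 0≤a 0≤d a≤b c≤d = ≤-trans
    (*-monoˡ-≤-nonNeg a {{nonNegative 0≤a}} c≤d)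
    (*-monoʳ-≤-nonNeg d {{nonNegative 0≤d}} a≤b)

  -- Packing the reciprocal with its equation confines the `NonZero` instance to this proof. The
  -- lemmas on inverses below ask only for such an equation, so they apply to `recipℚ` as well.
  inverse : ∀ {x} → 0ℚ < x → ∃[ y ] (0ℚ < y × y * x ≡ 1ℚ)
  inverse {x} 0<x = 1/ x , positive⁻¹ (1/ x) {{1/pos⇒pos x}} , *-inverseˡ x
    where instance
      x>0 = positive 0<x
      x≢0 = pos⇒nonZero x

  inverse-cancelʳ : ∀ x y {y⁻¹} → y⁻¹ * y ≡ 1ℚ → y⁻¹ * (x * y) ≡ x
  inverse-cancelʳ x y {v} vy≡1 = begin
    v * (x * y) ≡⟨ solve 3 (λ v x y → v :* (x :* y) := (v :* y) :* x) refl v x y ⟩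
    (v * y) * x ≡⟨ cong (_* x) vy≡1 ⟩
    1ℚ * x      ≡⟨ *-identityˡ x ⟩
    x           ∎
    where open ≡-Reasoning

  inverse-cancelˡ : ∀ x y {x⁻¹} → x⁻¹ * x ≡ 1ℚ → x⁻¹ * (x * y) ≡ y
  inverse-cancelˡ x y {u} ux≡1 = trans (cong (u *_) (*-comm x y)) (inverse-cancelʳ y x {u} ux≡1)

  inverse-antimono-≤ : ∀ {x y} → 0ℚ < x → 0ℚ < y → ∀ {x⁻¹ y⁻¹} →
    x⁻¹ * x ≡ 1ℚ → y⁻¹ * y ≡ 1ℚ → x ≤ y → y⁻¹ ≤ x⁻¹
  inverse-antimono-≤ {x} {y} 0<x 0<y {u} {v} ux≡1 vy≡1 x≤y =
    *-cancelʳ-≤-pos (x * y) {{positive (*-pos 0<x 0<y)}}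
      (subst₂ _≤_ (sym (inverse-cancelʳ x y {v} vy≡1)) (sym (inverse-cancelˡ x y {u} ux≡1)) x≤y)

  inverse-antimono-< : ∀ {x y} → 0ℚ < x → 0ℚ < y → ∀ {x⁻¹ y⁻¹} →
    x⁻¹ * x ≡ 1ℚ → y⁻¹ * y ≡ 1ℚ → x < y → y⁻¹ < x⁻¹
  inverse-antimono-< {x} {y} 0<x 0<y {u} {v} ux≡1 vy≡1 x<y =
    *-cancelʳ-<-nonNeg (x * y) {{nonNegative (<⇒≤ (*-pos 0<x 0<y))}}
      (subst₂ _<_ (sym (inverse-cancelʳ x y {v} vy≡1)) (sym (inverse-cancelˡ x y {u} ux≡1)) x<y)

  small-multiple : ∀ {K g} → 0ℚ ≤ K → 0ℚ < g → ∃[ t ] (0ℚ < t × t ≤ 1ℚ × K * t < g)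
  small-multiple {K} {g} 0≤K 0<g = bound (inverse 0<s)
    where
    s = K + g + 1ℚ

    0<1 : 0ℚ < 1ℚ
    0<1 = positive⁻¹ 1ℚ

    0<s : 0ℚ < s
    0<s = +-mono-≤-< (+-nonneg 0≤K (<⇒≤ 0<g)) 0<1

    -- The witness is `t = g / (K + g + 1)`: the summand `g` in the denominator gives `t ≤ 1`, and
    -- `K < s` gives `K * t < g`.
    bound : ∃[ w ] (0ℚ < w × w * s ≡ 1ℚ) → ∃[ t ] (0ℚ < t × t ≤ 1ℚ × K * t < g)
    bound (w , 0<w , ws≡1) = g * w , *-pos 0<g 0<w ,
      excess (w * K + w)
        (+-nonneg (*-nonneg (<⇒≤ 0<w) 0≤K) (<⇒≤ 0<w))
        (trans (sym ws≡1)
          (solve 3 (λ w K g → w :* (K :+ g :+ con 1ℚ) := g :* w :+ (w :* K :+ w)) refl w K g)) ,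
      subst₂ _<_ (lem₁ w K g) (trans (cong (g *_) ws≡1) (*-identityʳ g))
        (*-monoʳ-<-pos g {{positive 0<g}} (*-monoʳ-<-pos w {{positive 0<w}} K<s))
      where
      lem₁ : ∀ w K g → g * (w * K) ≡ K * (g * w)
      lem₁ = solve 3 (λ w K g → g :* (w :* K) := K :* (g :* w)) refl
      K<s : K < s
      K<s = subst₂ _<_ (+-identityʳ K) (sym (+-assoc K g 1ℚ))
        (+-monoʳ-< K (+-mono-<-≤ 0<g 0≤1))

  ≤-limit : ∀ {a b} → (∀ ε → 0ℚ < ε → a ≤ b + ε) → a ≤ b
  ≤-limit {a} {b} a≤b+ with a ≤? b
  ... | yes a≤b = a≤b
  ... | no  a≰b with <-dense (≰⇒> a≰b)
  ... | m , b<m , m<a = contradiction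
    (<-≤-trans m<a (subst (a ≤_)
      (solve 2 (λ b m → b :+ (m :- b) := m) refl b m)
      (a≤b+ (m - b) (p<q⇒0<q-p b<m))))
    (<-irrefl refl)

  ∣p∣≤ : ∀ {p c} → p ≤ c → - p ≤ c → ℚ.∣ p ∣ ≤ c
  ∣p∣≤ {p} {c} p≤c -p≤c with ∣p∣≡p∨∣p∣≡-p p
  ... | inj₁ eq = subst (_≤ c) (sym eq) p≤c
  ... | inj₂ eq = subst (_≤ c) (sym eq) -p≤c

  p≤∣p∣ : ∀ p → p ≤ ℚ.∣ p ∣
  p≤∣p∣ p with ≤-total 0ℚ p
  ... | inj₁ 0≤p = ≤-reflexive (sym (0≤p⇒∣p∣≡p 0≤p))
  ... | inj₂ p≤0 = ≤-trans p≤0 (0≤∣p∣ p)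

  ∣p-q∣≤1 : ∀ {p q} → 0ℚ ≤ p → p ≤ 1ℚ → 0ℚ ≤ q → q ≤ 1ℚ → ℚ.∣ p - q ∣ ≤ 1ℚ
  ∣p-q∣≤1 {p} {q} 0≤p p≤1 0≤q q≤1 = ∣p∣≤ (+-mono-≤ p≤1 (neg-antimono-≤ 0≤q))
    (subst (_≤ 1ℚ) (solve 2 (λ p q → q :- p := :- (p :- q)) refl p q)
      (+-mono-≤ q≤1 (neg-antimono-≤ 0≤p)))

  ∣p*q∣≤ : ∀ {a b} p q → ℚ.∣ p ∣ ≤ a → ℚ.∣ q ∣ ≤ b → ℚ.∣ p * q ∣ ≤ a * b
  ∣p*q∣≤ {a} {b} p q ∣p∣≤a ∣q∣≤b = subst (_≤ a * b) (sym (∣p*q∣≡∣p∣*∣q∣ p q))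
    (*-mono-≤-nonneg (0≤∣p∣ p) (≤-trans (0≤∣p∣ q) ∣q∣≤b) ∣p∣≤a ∣q∣≤b)

  open import Algebra.Definitions.RawSemiring +-*-rawSemiring using (_^_) public

  ^-nonneg : ∀ {x} → 0ℚ ≤ x → ∀ m → 0ℚ ≤ x ^ m
  ^-nonneg 0≤x zero    = 0≤1
  ^-nonneg 0≤x (suc m) = *-nonneg 0≤x (^-nonneg 0≤x m)

  ^-monoˡ : ∀ {x y} → 0ℚ ≤ x → x ≤ y → ∀ m → x ^ m ≤ y ^ m
  ^-monoˡ 0≤x x≤y zero    = ≤-refl
  ^-monoˡ 0≤x x≤y (suc m) =
    *-mono-≤-nonneg 0≤x (^-nonneg (≤-trans 0≤x x≤y) m) x≤y (^-monoˡ 0≤x x≤y m)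

  1≤1+nonneg : ∀ {h} → 0ℚ ≤ h → 1ℚ ≤ 1ℚ + h
  1≤1+nonneg {h} 0≤h = excess h 0≤h refl

  1≤x^m : ∀ {x} → 1ℚ ≤ x → ∀ m → 1ℚ ≤ x ^ m
  1≤x^m 1≤x zero    = ≤-refl
  1≤x^m 1≤x (suc m) = *-mono-≤-nonneg 0≤1 (≤-trans 0≤1 (1≤x^m 1≤x m)) 1≤x (1≤x^m 1≤x m)

  ^-monoʳ : ∀ {x m n} → 1ℚ ≤ x → m ℕ.≤ n → x ^ m ≤ x ^ n
  ^-monoʳ {n = n} 1≤x ℕ.z≤n       = 1≤x^m 1≤x n
  ^-monoʳ {x} 1≤x (ℕ.s≤s m≤n) =
    *-monoˡ-≤-nonNeg x {{nonNegative (≤-trans 0≤1 1≤x)}} (^-monoʳ 1≤x m≤n)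

  -- Every term of the sequence of `fromℕ n` is definitionally `ι n`.
  ι : ℕ → ℚ
  ι n = + n / 1

  ι-suc : ∀ n → ι (suc n) ≡ 1ℚ + ι n
  ι-suc n = toℚᵘ-injective (begin
    toℚᵘ (ι (suc n))          ≈⟨ toℚᵘ-fromℚᵘ (ℚᵘ.mkℚᵘ (+ suc n) 0) ⟩
    ℚᵘ.mkℚᵘ (+ suc n) 0       ≈⟨ ℚᵘ.*≡* (cong (λ z → (+ 1 ℤ.+ z) ℤ.* + 1) (sym (ℤ.*-identityʳ (+ n)))) ⟩
    ℚᵘ.mkℚᵘ (+ 1) 0 ℚᵘ.+ ℚᵘ.mkℚᵘ (+ n) 0
      ≈⟨ ℚᵘ.+-congʳ (ℚᵘ.mkℚᵘ (+ 1) 0) (toℚᵘ-fromℚᵘ (ℚᵘ.mkℚᵘ (+ n) 0)) ⟨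
    toℚᵘ 1ℚ ℚᵘ.+ toℚᵘ (ι n)   ≈⟨ toℚᵘ-homo-+ 1ℚ (ι n) ⟨
    toℚᵘ (1ℚ + ι n) ∎)
    where open import Relation.Binary.Reasoning.Setoid ℚᵘ.≃-setoid

  0≤ι : ∀ n → 0ℚ ≤ ι n
  0≤ι n = nonNegative⁻¹ (ι n) {{normalize-nonNeg n 1}}

  0<ι : ∀ n .{{_ : NonZero n}} → 0ℚ < ι n
  0<ι n = positive⁻¹ (ι n) {{normalize-pos n 1}}

  archimedean : ∀ x → ∃[ m ] x ≤ ι m
  archimedean x@(mkℚ (+ n)    d _) = n , toℚᵘ-cancel-≤
    (ℚᵘ.≤-respʳ-≃ (ℚᵘ.≃-sym (toℚᵘ-fromℚᵘ (ℚᵘ.mkℚᵘ (+ n) 0)))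
      (ℚᵘ.*≤* (ℤ.*-monoˡ-≤-nonNeg (+ n) (ℤ.+≤+ (ℕ.s≤s ℕ.z≤n)))))
  archimedean x@(mkℚ -[1+ n ] d _) = 0 , *≤* ℤ.-≤+

  archimedean-multiple : ∀ a {b} → 0ℚ < b → ∃[ m ] a ≤ ι m * b
  archimedean-multiple a {b} 0<b with inverse 0<b
  ... | w , 0<w , wb≡1 with archimedean (a * w)
  ... | m , aw≤m = m , subst (_≤ ι m * b)
    (trans (*-assoc a w b) (trans (cong (a *_) wb≡1) (*-identityʳ a)))
    (*-monoʳ-≤-nonNeg b {{nonNegative (<⇒≤ 0<b)}} aw≤m)

  ι*unit : ∀ m n .{{_ : NonZero m}} .{{_ : NonZero n}} .{{_ : NonZero (m ℕ.* n)}} →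
    ι m * (+ 1 / (m ℕ.* n)) ≡ + 1 / n
  ι*unit m@(suc _) n@(suc n′) = toℚᵘ-injective (begin
    toℚᵘ (ι m * u)          ≈⟨ toℚᵘ-homo-* (ι m) u ⟩
    toℚᵘ (ι m) ℚᵘ.* toℚᵘ u
      ≈⟨ ℚᵘ.*-cong (toℚᵘ-fromℚᵘ (ℚᵘ.mkℚᵘ (+ m) 0)) (toℚᵘ-fromℚᵘ (ℚᵘ.mkℚᵘ (+ 1) _)) ⟩
    ℚᵘ.mkℚᵘ (+ m) 0 ℚᵘ.* ℚᵘ.mkℚᵘ (+ 1) _
      ≈⟨ ℚᵘ.*≡* (cong +_ (trans (cong (ℕ._* n) (ℕ.*-identityʳ m)) (sym (trans (ℕ.*-identityˡ _) (ℕ.*-identityˡ _))))) ⟩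
    ℚᵘ.mkℚᵘ (+ 1) n′        ≈⟨ toℚᵘ-fromℚᵘ (ℚᵘ.mkℚᵘ (+ 1) n′) ⟨
    toℚᵘ (+ 1 / n) ∎)
    where
    u = + 1 / (m ℕ.* n)
    open import Relation.Binary.Reasoning.Setoid ℚᵘ.≃-setoid

module SecondMomentMethod where
  open import Data.Rational.Base as ℚ hiding (NonZero; ∣_∣)
  open import Data.Rational.Properties
  open import Data.Rational.Solver using (module +-*-Solver)
  open +-*-Solver using (solve; con; _:=_; _:+_; _:*_; _:-_; :-_)
  open Rationals

  private variable
    n : ℕ
    ℓ : Level

  -- Taylor polynomials of exp, and (1 + 1 / k) ^ k < e.

  taylor : ℕ → ℚ → ℚ
  taylor zero    x = 1ℚ
  taylor (suc m) x = taylor m x + x ^ suc m * 1/ suc m !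

  taylor-1 : ∀ m → taylor m 1ℚ ≡ ∑1/i! m
  taylor-1 zero    = refl
  taylor-1 (suc m) = cong₂ _+_ (taylor-1 m)
    (trans (cong (_* 1/ suc m !) (1^ (suc m))) (*-identityˡ _))
    where
    1^ : ∀ m → 1ℚ ^ m ≡ 1ℚ
    1^ zero    = refl
    1^ (suc m) = trans (*-identityˡ _) (1^ m)

  0<1/n! : ∀ m → 0ℚ < 1/ m !
  0<1/n! m = positive⁻¹ (1/ m !) {{normalize-pos 1 (m ℕ.!) {{m ℕ.!≢0}}}}

  ι*1/n! : ∀ m → ι (suc m) * 1/ suc m ! ≡ 1/ m !
  ι*1/n! m = ι*unit (suc m) (m ℕ.!) {{_}} {{m ℕ.!≢0}} {{suc m ℕ.!≢0}}

  -- These are the first two terms of the binomial expansion. In the induction step the only surplus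
  -- is the term in `h * h`, which is nonnegative and dropped.
  bernoulli-inequality : ∀ {x h} → 0ℚ ≤ x → 0ℚ ≤ h → ∀ m →
    x ^ suc m + ι (suc m) * (h * x ^ m) ≤ (x + h) ^ suc m
  bernoulli-inequality {x} {h} 0≤x 0≤h zero = ≤-reflexive
    (solve 2 (λ x h → x :* con 1ℚ :+ con 1ℚ :* (h :* con 1ℚ) := (x :+ h) :* con 1ℚ) refl x h)
  bernoulli-inequality {x} {h} 0≤x 0≤h (suc m) = ≤-trans
    (excess (h * h * (ι (suc m) * x ^ m))
      (*-nonneg (*-nonneg 0≤h 0≤h) (*-nonneg (0≤ι (suc m)) (^-nonneg 0≤x m)))
      (trans (lem x h (ι (suc m)) (x ^ m))
        (cong (λ c → x ^ suc (suc m) + c * (h * x ^ suc m) + h * h * (ι (suc m) * x ^ m))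
          (sym (ι-suc (suc m))))))
    (*-monoˡ-≤-nonNeg (x + h) {{nonNegative (+-nonneg 0≤x 0≤h)}}
      (bernoulli-inequality 0≤x 0≤h m))
    where
    lem : ∀ x h c y → (x + h) * (x * y + c * (h * y)) ≡
          x * (x * y) + (1ℚ + c) * (h * (x * y)) + h * h * (c * y)
    lem = solve 4 (λ x h c y → (x :+ h) :* (x :* y :+ c :* (h :* y)) :=
          x :* (x :* y) :+ (con 1ℚ :+ c) :* (h :* (x :* y)) :+ h :* h :* (c :* y)) refl

  -- The derivative of `taylor (suc m)` is `taylor m`, so this is the tangent-line inequality for a
  -- polynomial convex on the nonnegative half-line. It is proved term by term from
  -- `bernoulli-inequality`.
  taylor-step : ∀ {x h} → 0ℚ ≤ x → 0ℚ ≤ h → ∀ m →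
    taylor (suc m) x + h * taylor m x ≤ taylor (suc m) (x + h)
  taylor-step {x} {h} 0≤x 0≤h zero = ≤-reflexive
    (solve 2 (λ x h → (con 1ℚ :+ x :* con 1ℚ :* con 1ℚ) :+ h :* con 1ℚ
                    := con 1ℚ :+ (x :+ h) :* con 1ℚ :* con 1ℚ) refl x h)
  taylor-step {x} {h} 0≤x 0≤h (suc m) = subst (_≤ taylor (suc (suc m)) (x + h))
    (trans (lem (taylor (suc m) x) (taylor m x) (x ^ suc (suc m)) (x ^ suc m) h
             (ι (suc (suc m))) (1/ suc (suc m) !))
      (cong (λ z → taylor (suc m) x + x ^ suc (suc m) * 1/ suc (suc m) !
                   + h * (taylor m x + x ^ suc m * z)) (ι*1/n! (suc m))))
    (+-mono-≤ (taylor-step 0≤x 0≤h m)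
      (*-monoʳ-≤-nonNeg (1/ suc (suc m) !) {{nonNegative (<⇒≤ (0<1/n! (suc (suc m))))}}
        (bernoulli-inequality 0≤x 0≤h (suc m))))
    where
    lem : ∀ t s y z h c a → t + h * s + (y + c * (h * z)) * a ≡
          t + y * a + h * (s + z * (c * a))
    lem = solve 7 (λ t s y z h c a → t :+ h :* s :+ (y :+ c :* (h :* z)) :* a :=
          t :+ y :* a :+ h :* (s :+ z :* (c :* a))) refl

  -- A rational substitute for `1 + h ≤ exp h` raised to the power `m`: each further factor `1 + h`
  -- is paid for by one more Taylor term and a shift of the argument by `h`.
  1+h^m≤taylor : ∀ {h} → 0ℚ ≤ h → ∀ m → (1ℚ + h) ^ m ≤ taylor m (ι m * h)
  1+h^m≤taylor {h} 0≤h zero    = ≤-refl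
  1+h^m≤taylor {h} 0≤h (suc m) = begin
    (1ℚ + h) * (1ℚ + h) ^ m
      ≤⟨ *-monoˡ-≤-nonNeg (1ℚ + h) {{nonNegative (+-nonneg 0≤1 0≤h)}} (1+h^m≤taylor 0≤h m) ⟩
    (1ℚ + h) * taylor m x
      ≤⟨ excess (x ^ suc m * 1/ suc m !)
          (*-nonneg (^-nonneg 0≤x (suc m)) (<⇒≤ (0<1/n! (suc m))))
          (solve 3 (λ t h y → t :+ y :+ h :* t := (con 1ℚ :+ h) :* t :+ y) refl (taylor m x) h _) ⟩
    taylor (suc m) x + h * taylor m x
      ≤⟨ taylor-step 0≤x 0≤h m ⟩
    taylor (suc m) (x + h)
      ≡⟨ cong (taylor (suc m)) (trans (cong (λ c → c * h) (ι-suc m))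
           (solve 2 (λ c h → (con 1ℚ :+ c) :* h := c :* h :+ h) refl (ι m) h)) ⟨
    taylor (suc m) (ι (suc m) * h) ∎
    where
    open ≤-Reasoning
    x = ι m * h
    0≤x : 0ℚ ≤ x
    0≤x = *-nonneg (0≤ι m) 0≤h

  -- With `h = 1 / k` the Taylor argument is 1. The partial sum up to `k` already gives a weak
  -- inequality; its next term makes it strict.
  1+1/k^k<∑1/i! : ∀ k {h} → 0ℚ ≤ h → ι k * h ≡ 1ℚ → (1ℚ + h) ^ k < ∑1/i! (suc k)
  1+1/k^k<∑1/i! k {h} 0≤h kh≡1 = ≤-<-trans
    (subst ((1ℚ + h) ^ k ≤_) (trans (cong (taylor k) kh≡1) (taylor-1 k)) (1+h^m≤taylor 0≤h k))
    (subst (_< ∑1/i! (suc k)) (+-identityʳ _) (+-monoʳ-< (∑1/i! k) (0<1/n! (suc k))))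

  ∑1/i!-mono : ∀ {m n} → m ℕ.≤′ n → ∑1/i! m ≤ ∑1/i! n
  ∑1/i!-mono (ℕ.≤′-reflexive refl) = ≤-refl
  ∑1/i!-mono (ℕ.≤′-step {n} m≤n) = ≤-trans (∑1/i!-mono m≤n)
    (excess (1/ suc n !) (<⇒≤ (0<1/n! (suc n))) refl)

  -- Integration against product weights on subsets.

  Weights : ℕ → Set
  Weights n = Vec (ℚ × ℚ) n

  -- Each pair holds the factors for leaving out and for taking one element. Expectations, sums over
  -- subsets of a set and costs are all instances, so linearity and monotonicity are proved once.
  ∫ : Weights n → (Subset n → ℚ) → ℚ
  ∫ []            f = f []
  ∫ ((a , b) ∷ ω) f = a * ∫ ω (f ∘ (outside ∷_)) + b * ∫ ω (f ∘ (inside ∷_))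

  mass : Weights n → Subset n → ℚ
  mass []            []            = 1ℚ
  mass ((a , b) ∷ ω) (outside ∷ S) = a * mass ω S
  mass ((a , b) ∷ ω) (inside  ∷ S) = b * mass ω S

  NonNegativeWeights : Weights n → Set
  NonNegativeWeights = All λ (a , b) → 0ℚ ≤ a × 0ℚ ≤ b

  ∫-cong : ∀ (ω : Weights n) {f g} → (∀ S → f S ≡ g S) → ∫ ω f ≡ ∫ ω g
  ∫-cong []            f≡g = f≡g []
  ∫-cong ((a , b) ∷ ω) f≡g = cong₂ (λ x y → a * x + b * y)
    (∫-cong ω (f≡g ∘ (outside ∷_))) (∫-cong ω (f≡g ∘ (inside ∷_)))

  ∫-mono : ∀ {ω : Weights n} → NonNegativeWeights ω → ∀ {f g} →
    (∀ S → f S ≤ g S) → ∫ ω f ≤ ∫ ω g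
  ∫-mono []                  f≤g = f≤g []
  ∫-mono {ω = (a , b) ∷ _} ((0≤a , 0≤b) ∷ 0≤ω) f≤g = +-mono-≤
    (*-monoˡ-≤-nonNeg a {{nonNegative 0≤a}} (∫-mono 0≤ω (f≤g ∘ (outside ∷_))))
    (*-monoˡ-≤-nonNeg b {{nonNegative 0≤b}} (∫-mono 0≤ω (f≤g ∘ (inside ∷_))))

  ∫-linear : ∀ (ω : Weights n) c f d g →
    ∫ ω (λ S → c * f S + d * g S) ≡ c * ∫ ω f + d * ∫ ω g
  ∫-linear []            c f d g = refl
  ∫-linear ((a , b) ∷ ω) c f d g = trans
    (cong₂ (λ x y → a * x + b * y)
      (∫-linear ω c (f ∘ (outside ∷_)) d (g ∘ (outside ∷_)))
      (∫-linear ω c (f ∘ (inside ∷_)) d (g ∘ (inside ∷_))))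
    (solve 8 (λ a b c d x y z w → a :* (c :* x :+ d :* y) :+ b :* (c :* z :+ d :* w) :=
                c :* (a :* x :+ b :* z) :+ d :* (a :* y :+ b :* w)) refl a b c d
       (∫ ω (f ∘ (outside ∷_))) (∫ ω (g ∘ (outside ∷_)))
       (∫ ω (f ∘ (inside ∷_))) (∫ ω (g ∘ (inside ∷_))))

  ∫-scale : ∀ (ω : Weights n) c f → ∫ ω (λ S → c * f S) ≡ c * ∫ ω f
  ∫-scale ω c f = trans (∫-cong ω (λ S → lem c (f S))) (trans (∫-linear ω c f 0ℚ f) (sym (lem c (∫ ω f))))
    where
    lem : ∀ c x → c * x ≡ c * x + 0ℚ * x
    lem = solve 2 (λ c x → c :* x := c :* x :+ con 0ℚ :* x) refl

  ∫-zero : ∀ (ω : Weights n) → ∫ ω (λ _ → 0ℚ) ≡ 0ℚ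
  ∫-zero ω = trans (∫-scale ω 0ℚ (λ _ → 0ℚ)) (*-zeroˡ (∫ ω (λ _ → 0ℚ)))

  ∫-nonneg : ∀ {ω : Weights n} → NonNegativeWeights ω → ∀ {f} → (∀ S → 0ℚ ≤ f S) → 0ℚ ≤ ∫ ω f
  ∫-nonneg {ω = ω} 0≤ω {f} 0≤f = subst (_≤ ∫ ω f) (∫-zero ω) (∫-mono 0≤ω 0≤f)

  -- If both slices of `f` are multiples of one `g`, the first coordinate splits off. This reduces
  -- the mean, correlation and cost computations to identities in a single coordinate.
  ∫-factor : ∀ a b (ω : Weights n) f g u v →
    (∀ S → f (outside ∷ S) ≡ u * g S) → (∀ S → f (inside ∷ S) ≡ v * g S) →
    ∫ ((a , b) ∷ ω) f ≡ (a * u + b * v) * ∫ ω g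
  ∫-factor a b ω f g u v eq₀ eq₁ = trans
    (cong₂ (λ x y → a * x + b * y)
      (trans (∫-cong ω eq₀) (∫-scale ω u g)) (trans (∫-cong ω eq₁) (∫-scale ω v g)))
    (solve 5 (λ a b u v x → a :* (u :* x) :+ b :* (v :* x) := (a :* u :+ b :* v) :* x) refl
      a b u v (∫ ω g))

  -- ∫ (bernoulli q) is the expectation over the q-random set, ∫ (below A)
  -- sums over the subsets of A, and ∫ (size p) sums S with weight p ^ ∣ S ∣.
  bernoulli : ℚ → Weights n
  bernoulli q = replicate _ (1ℚ - q , q)

  below : Subset n → Weights n
  below = map λ s → 1ℚ , (if s then 1ℚ else 0ℚ)

  size : ℚ → Weights n
  size p = replicate _ (1ℚ , p)

  bernoulli-nonneg : ∀ n {q} → 0ℚ ≤ q → q ≤ 1ℚ → NonNegativeWeights (bernoulli {n} q)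
  bernoulli-nonneg zero    0≤q q≤1 = []
  bernoulli-nonneg (suc n) 0≤q q≤1 = (p≤q⇒0≤q-p q≤1 , 0≤q) ∷ bernoulli-nonneg n 0≤q q≤1

  below-nonneg : (A : Subset n) → NonNegativeWeights (below A)
  below-nonneg []            = []
  below-nonneg (inside  ∷ A) = (0≤1 , 0≤1) ∷ below-nonneg A
  below-nonneg (outside ∷ A) = (0≤1 , ≤-refl) ∷ below-nonneg A

  size-nonneg : ∀ n {p} → 0ℚ ≤ p → NonNegativeWeights (size {n} p)
  size-nonneg zero    0≤p = []
  size-nonneg (suc n) 0≤p = (0≤1 , 0≤p) ∷ size-nonneg n 0≤p

  bernoulli-const : ∀ n q c → ∫ (bernoulli {n} q) (λ _ → c) ≡ c
  bernoulli-const zero    q c = refl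
  bernoulli-const (suc n) q c rewrite bernoulli-const n q c =
    solve 2 (λ q c → (con 1ℚ :- q) :* c :+ q :* c := c) refl q c

  expectation-0≤ : ∀ {q} → 0ℚ ≤ q → q ≤ 1ℚ → ∀ {f : Subset n → ℚ} →
    (∀ S → 0ℚ ≤ f S) → 0ℚ ≤ ∫ (bernoulli q) f
  expectation-0≤ {n} 0≤q q≤1 = ∫-nonneg (bernoulli-nonneg n 0≤q q≤1)

  expectation-≤ : ∀ {q c} → 0ℚ ≤ q → q ≤ 1ℚ → ∀ {f : Subset n → ℚ} →
    (∀ S → f S ≤ c) → ∫ (bernoulli q) f ≤ c
  expectation-≤ {n} {q} {c} 0≤q q≤1 {f} f≤c = subst (∫ (bernoulli q) f ≤_) (bernoulli-const n q c)
    (∫-mono (bernoulli-nonneg n 0≤q q≤1) f≤c)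

  -- Lipschitz dependence of the expectation on the bias.

  lipschitz : ℕ → ℚ
  lipschitz zero    = 0ℚ
  lipschitz (suc n) = (1ℚ + 1ℚ + (1ℚ + 1ℚ)) * lipschitz n + 1ℚ

  lipschitz-nonneg : ∀ n → 0ℚ ≤ lipschitz n
  lipschitz-nonneg zero    = ≤-refl
  lipschitz-nonneg (suc n) = +-nonneg (*-nonneg (nonNegative⁻¹ _) (lipschitz-nonneg n)) 0≤1

  -- The bias `a` will be a term of a sequence for `k p` and may leave the unit interval, so only
  -- `∣ a ∣` and `∣ 1 - a ∣` at most 2 are available. These two bounds produce the factor 4 in
  -- `lipschitz`; changing the bias of the first coordinate produces the summand 1.
  expectation-lipschitz : ∀ n {a b η} → 0ℚ ≤ b → b ≤ 1ℚ → ℚ.∣ a - b ∣ ≤ η → η ≤ 1ℚ →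
    ∀ {f : Subset n → ℚ} → (∀ S → 0ℚ ≤ f S) → (∀ S → f S ≤ 1ℚ) →
    ℚ.∣ ∫ (bernoulli a) f - ∫ (bernoulli b) f ∣ ≤ lipschitz n * η
  expectation-lipschitz zero {η = η} 0≤b b≤1 ∣a-b∣≤η η≤1 {f} 0≤f f≤1 =
    ≤-reflexive (trans (cong ℚ.∣_∣ (+-inverseʳ (f []))) (sym (*-zeroˡ η)))
  expectation-lipschitz (suc n) {a} {b} {η} 0≤b b≤1 ∣a-b∣≤η η≤1 {f} 0≤f f≤1 = begin
    ℚ.∣ (1ℚ - a) * A₀ + a * A₁ - ((1ℚ - b) * B₀ + b * B₁) ∣
      ≡⟨ cong ℚ.∣_∣ (lem a b A₀ A₁ B₀ B₁) ⟩
    ℚ.∣ (1ℚ - a) * (A₀ - B₀) + a * (A₁ - B₁) + (a - b) * (B₁ - B₀) ∣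
      ≤⟨ ≤-trans (∣p+q∣≤∣p∣+∣q∣ ((1ℚ - a) * (A₀ - B₀) + a * (A₁ - B₁)) _)
           (+-monoˡ-≤ _ (∣p+q∣≤∣p∣+∣q∣ ((1ℚ - a) * (A₀ - B₀)) (a * (A₁ - B₁)))) ⟩
    ℚ.∣ (1ℚ - a) * (A₀ - B₀) ∣ + ℚ.∣ a * (A₁ - B₁) ∣ + ℚ.∣ (a - b) * (B₁ - B₀) ∣
      ≤⟨ +-mono-≤ (+-mono-≤
           (∣p*q∣≤ (1ℚ - a) (A₀ - B₀) ∣1-a∣≤2 (IH (0≤f ∘ (outside ∷_)) (f≤1 ∘ (outside ∷_))))
           (∣p*q∣≤ a (A₁ - B₁) ∣a∣≤2 (IH (0≤f ∘ (inside ∷_)) (f≤1 ∘ (inside ∷_)))))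
           (∣p*q∣≤ (a - b) (B₁ - B₀) ∣a-b∣≤η
             (∣p-q∣≤1 (0≤E (0≤f ∘ (inside ∷_))) (E≤1 (f≤1 ∘ (inside ∷_)))
                      (0≤E (0≤f ∘ (outside ∷_))) (E≤1 (f≤1 ∘ (outside ∷_))))) ⟩
    (1ℚ + 1ℚ) * (lipschitz n * η) + (1ℚ + 1ℚ) * (lipschitz n * η) + η * 1ℚ
      ≡⟨ solve 3 (λ c L η → c :* (L :* η) :+ c :* (L :* η) :+ η :* con 1ℚ :=
           ((c :+ c) :* L :+ con 1ℚ) :* η) refl (1ℚ + 1ℚ) (lipschitz n) η ⟩
    lipschitz (suc n) * η ∎
    where
    open ≤-Reasoning
    A₀ = ∫ (bernoulli a) (f ∘ (outside ∷_))
    A₁ = ∫ (bernoulli a) (f ∘ (inside ∷_))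
    B₀ = ∫ (bernoulli b) (f ∘ (outside ∷_))
    B₁ = ∫ (bernoulli b) (f ∘ (inside ∷_))
    IH : ∀ {g : Subset n → ℚ} → (∀ S → 0ℚ ≤ g S) → (∀ S → g S ≤ 1ℚ) →
      ℚ.∣ ∫ (bernoulli a) g - ∫ (bernoulli b) g ∣ ≤ lipschitz n * η
    IH = expectation-lipschitz n 0≤b b≤1 ∣a-b∣≤η η≤1
    0≤E : ∀ {g : Subset n → ℚ} → (∀ S → 0ℚ ≤ g S) → 0ℚ ≤ ∫ (bernoulli b) g
    0≤E = expectation-0≤ 0≤b b≤1
    E≤1 : ∀ {g : Subset n → ℚ} → (∀ S → g S ≤ 1ℚ) → ∫ (bernoulli b) g ≤ 1ℚ
    E≤1 = expectation-≤ 0≤b b≤1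
    ∣a-b∣≤1 = ≤-trans ∣a-b∣≤η η≤1
    ∣a∣≤2 : ℚ.∣ a ∣ ≤ 1ℚ + 1ℚ
    ∣a∣≤2 = subst (λ z → ℚ.∣ z ∣ ≤ 1ℚ + 1ℚ) (solve 2 (λ a b → (a :- b) :+ b := a) refl a b)
      (≤-trans (∣p+q∣≤∣p∣+∣q∣ (a - b) b)
        (+-mono-≤ ∣a-b∣≤1 (subst (_≤ 1ℚ) (sym (0≤p⇒∣p∣≡p 0≤b)) b≤1)))
    ∣1-a∣≤2 : ℚ.∣ 1ℚ - a ∣ ≤ 1ℚ + 1ℚ
    ∣1-a∣≤2 = subst (λ z → ℚ.∣ z ∣ ≤ 1ℚ + 1ℚ)
      (solve 2 (λ a b → (con 1ℚ :- b) :- (a :- b) := con 1ℚ :- a) refl a b)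
      (≤-trans (∣p-q∣≤∣p∣+∣q∣ (1ℚ - b) (a - b))
        (+-mono-≤ (∣p-q∣≤1 0≤1 ≤-refl 0≤b b≤1) ∣a-b∣≤1))
    lem : ∀ a b A₀ A₁ B₀ B₁ → (1ℚ - a) * A₀ + a * A₁ - ((1ℚ - b) * B₀ + b * B₁) ≡
      (1ℚ - a) * (A₀ - B₀) + a * (A₁ - B₁) + (a - b) * (B₁ - B₀)
    lem = solve 6 (λ a b A₀ A₁ B₀ B₁ →
      (con 1ℚ :- a) :* A₀ :+ a :* A₁ :- ((con 1ℚ :- b) :* B₀ :+ b :* B₁) :=
      (con 1ℚ :- a) :* (A₀ :- B₀) :+ a :* (A₁ :- B₁) :+ (a :- b) :* (B₁ :- B₀)) refl

  -- Product kernels: conditional densities and their covers.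

  ⨂ : (Side → Side → ℚ) → Subset n → Subset n → ℚ
  ⨂ φ []      []      = 1ℚ
  ⨂ φ (a ∷ A) (s ∷ S) = φ a s * ⨂ φ A S

  -- For q = 1 / r, upDensity r A R = r ^ ∣ A ∣ if A ⊆ R and 0 otherwise: the
  -- density, with respect to μ_q, of the q-random set conditioned to contain A.
  upFactor : ℚ → Side → Side → ℚ
  upFactor r inside  inside  = r
  upFactor r inside  outside = 0ℚ
  upFactor r outside _       = 1ℚ

  upDensity : ℚ → Subset n → Subset n → ℚ
  upDensity r = ⨂ (upFactor r)

  -- coverWeight r B S = (r - 1) ^ ∣ S ∣ if S ⊆ B and 0 otherwise.
  coverFactor : ℚ → Side → Side → ℚ
  coverFactor r inside  inside  = r - 1ℚ
  coverFactor r outside inside  = 0ℚ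
  coverFactor r _       outside = 1ℚ

  coverWeight : ℚ → Subset n → Subset n → ℚ
  coverWeight r = ⨂ (coverFactor r)

  upDensity-nonneg : ∀ {r} → 0ℚ ≤ r → (A R : Subset n) → 0ℚ ≤ upDensity r A R
  upDensity-nonneg 0≤r []      []      = 0≤1
  upDensity-nonneg 0≤r (a ∷ A) (s ∷ R) = *-nonneg (factor a s) (upDensity-nonneg 0≤r A R)
    where
    factor : ∀ a s → 0ℚ ≤ upFactor _ a s
    factor inside  inside  = 0≤r
    factor inside  outside = ≤-refl
    factor outside _       = 0≤1

  -- The exponent `n` in place of `∣ A ∣` is crude, but makes the bound uniform over all `A`, as the
  -- descent requires.
  upDensity-≤ : ∀ {r} → 1ℚ ≤ r → (A R : Subset n) → upDensity r A R ≤ r ^ n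
  upDensity-≤         1≤r []      []      = ≤-refl
  upDensity-≤ {n = suc n} {r = r} 1≤r (a ∷ A) (s ∷ R) = *-mono-≤-nonneg
    (factor-nonneg a s) (≤-trans 0≤1 (1≤x^m 1≤r n)) (factor a s) (upDensity-≤ 1≤r A R)
    where
    factor-nonneg : ∀ a s → 0ℚ ≤ upFactor r a s
    factor-nonneg inside  inside  = ≤-trans 0≤1 1≤r
    factor-nonneg inside  outside = ≤-refl
    factor-nonneg outside _       = 0≤1
    factor : ∀ a s → upFactor r a s ≤ r
    factor inside  inside  = ≤-refl
    factor inside  outside = ≤-trans 0≤1 1≤r
    factor outside _       = 1≤r

  upDensity-support : ∀ r (A R : Subset n) → A ⊆ R ⊎ upDensity r A R ≡ 0ℚ
  upDensity-support r []            []            = inj₁ id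
  upDensity-support r (outside ∷ A) (s ∷ R) with upDensity-support r A R
  ... | inj₁ A⊆R = inj₁ (out⊆ A⊆R)
  ... | inj₂ eq  = inj₂ (trans (*-identityˡ _) eq)
  upDensity-support r (inside  ∷ A) (inside ∷ R) with upDensity-support r A R
  ... | inj₁ A⊆R = inj₁ (s⊆s A⊆R)
  ... | inj₂ eq  = inj₂ (trans (cong (r *_) eq) (*-zeroʳ r))
  upDensity-support r (inside  ∷ A) (outside ∷ R) = inj₂ (*-zeroˡ (upDensity r A R))

  upDensity-mean : ∀ {q r} → r * q ≡ 1ℚ → (A : Subset n) → ∫ (bernoulli q) (upDensity r A) ≡ 1ℚ
  upDensity-mean         rq≡1 []      = refl
  upDensity-mean {q = q} {r} rq≡1 (a ∷ A) = trans
    (∫-factor (1ℚ - q) q (bernoulli q) (upDensity r (a ∷ A)) (upDensity r A)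
      (upFactor r a outside) (upFactor r a inside) (λ _ → refl) (λ _ → refl))
    (trans (cong₂ _*_ (factor a) (upDensity-mean rq≡1 A)) (*-identityˡ 1ℚ))
    where
    factor : ∀ a → (1ℚ - q) * upFactor r a outside + q * upFactor r a inside ≡ 1ℚ
    factor inside  = trans
      (solve 2 (λ q r → (con 1ℚ :- q) :* con 0ℚ :+ q :* r := r :* q) refl q r) rq≡1
    factor outside = solve 1 (λ q → (con 1ℚ :- q) :* con 1ℚ :+ q :* con 1ℚ := con 1ℚ) refl q

  -- Both sides equal r ^ ∣ A ∩ B ∣, the right one by the binomial theorem.
  correlation : ∀ {q r} → r * q ≡ 1ℚ → (A B : Subset n) →
    ∫ (bernoulli q) (λ R → upDensity r B R * upDensity r A R) ≡ ∫ (below A) (coverWeight r B)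
  correlation rq≡1 [] [] = *-identityˡ 1ℚ
  correlation {q = q} {r} rq≡1 (a ∷ A) (b ∷ B) = trans
    (∫-factor (1ℚ - q) q (bernoulli q) 
      (λ R → upDensity r (b ∷ B) R * upDensity r (a ∷ A) R) (λ R → upDensity r B R * upDensity r A R)
      (upFactor r b outside * upFactor r a outside) (upFactor r b inside * upFactor r a inside)
      (λ R → interchange (upFactor r b outside) (upDensity r B R) (upFactor r a outside) (upDensity r A R))
      (λ R → interchange (upFactor r b inside) (upDensity r B R) (upFactor r a inside) (upDensity r A R)))
    (trans (cong₂ _*_ (factor a b) (correlation rq≡1 A B))
      (sym (∫-factor 1ℚ (if a then 1ℚ else 0ℚ) (below A) (coverWeight r (b ∷ B)) (coverWeight r B)
        (coverFactor r b outside) (coverFactor r b inside) (λ _ → refl) (λ _ → refl))))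
    where
    interchange : ∀ a b c d → a * b * (c * d) ≡ a * c * (b * d)
    interchange = solve 4 (λ a b c d → a :* b :* (c :* d) := a :* c :* (b :* d)) refl
    factor : ∀ a b →
      (1ℚ - q) * (upFactor r b outside * upFactor r a outside) + q * (upFactor r b inside * upFactor r a inside)
      ≡ 1ℚ * coverFactor r b outside + (if a then 1ℚ else 0ℚ) * coverFactor r b inside
    factor inside inside = trans
      (solve 2 (λ q r → (con 1ℚ :- q) :* (con 0ℚ :* con 0ℚ) :+ q :* (r :* r) := r :* (r :* q)) refl q r)
      (trans (cong (r *_) rq≡1)
        (solve 1 (λ r → r :* con 1ℚ := con 1ℚ :* con 1ℚ :+ con 1ℚ :* (r :- con 1ℚ)) refl r))
    factor inside outside = trans
      (solve 2 (λ q r → (con 1ℚ :- q) :* (con 1ℚ :* con 0ℚ) :+ q :* (con 1ℚ :* r) := r :* q) refl q r) rq≡1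
    factor outside inside = trans
      (solve 2 (λ q r → (con 1ℚ :- q) :* (con 0ℚ :* con 1ℚ) :+ q :* (r :* con 1ℚ) := r :* q) refl q r)
      (trans rq≡1
        (solve 1 (λ r → con 1ℚ := con 1ℚ :* con 1ℚ :+ con 0ℚ :* (r :- con 1ℚ)) refl r))
    factor outside outside =
      solve 1 (λ q → (con 1ℚ :- q) :* (con 1ℚ :* con 1ℚ) :+ q :* (con 1ℚ :* con 1ℚ) := con 1ℚ) refl q

  coverWeight-nonneg : ∀ {r} → 1ℚ ≤ r → (B S : Subset n) → 0ℚ ≤ coverWeight r B S
  coverWeight-nonneg 1≤r []      []      = 0≤1
  coverWeight-nonneg 1≤r (b ∷ B) (s ∷ S) = *-nonneg (factor b s) (coverWeight-nonneg 1≤r B S)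
    where
    factor : ∀ b s → 0ℚ ≤ coverFactor _ b s
    factor inside  inside  = p≤q⇒0≤q-p 1≤r
    factor outside inside  = ≤-refl
    factor inside  outside = 0≤1
    factor outside outside = 0≤1

  -- By the binomial theorem: each element of `B` contributes `1 + (r - 1) * p`, every other element
  -- contributes 1.
  coverWeight-cost : ∀ r p (B : Subset n) →
    ∫ (size p) (coverWeight r B) ≡ (1ℚ + (r - 1ℚ) * p) ^ ∣ B ∣
  coverWeight-cost r p []            = refl
  coverWeight-cost r p (inside  ∷ B) = trans
    (∫-factor 1ℚ p (size p) (coverWeight r (inside ∷ B)) (coverWeight r B) 1ℚ (r - 1ℚ) (λ _ → refl) (λ _ → refl))
    (cong₂ _*_ (solve 2 (λ r p → con 1ℚ :* con 1ℚ :+ p :* (r :- con 1ℚ)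
                                := con 1ℚ :+ (r :- con 1ℚ) :* p) refl r p)
      (coverWeight-cost r p B))
  coverWeight-cost r p (outside ∷ B) = trans
    (∫-factor 1ℚ p (size p) (coverWeight r (outside ∷ B)) (coverWeight r B) 1ℚ 0ℚ (λ _ → refl) (λ _ → refl))
    (trans (cong₂ _*_ (solve 1 (λ p → con 1ℚ :* con 1ℚ :+ p :* con 0ℚ := con 1ℚ) refl p)
                      (coverWeight-cost r p B))
      (*-identityˡ ((1ℚ + (r - 1ℚ) * p) ^ ∣ B ∣)))

  -- Mixtures of densities and the second-moment bound.

  convex-nonneg : ∀ {s t a b} → 0ℚ ≤ s → 0ℚ ≤ t → 0ℚ ≤ a → 0ℚ ≤ b → 0ℚ ≤ s * a + t * b
  convex-nonneg 0≤s 0≤t 0≤a 0≤b = +-nonneg (*-nonneg 0≤s 0≤a) (*-nonneg 0≤t 0≤b)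

  convex-≤ : ∀ {t a b c} → 0ℚ ≤ 1ℚ - t → 0ℚ ≤ t → a ≤ c → b ≤ c → (1ℚ - t) * a + t * b ≤ c
  convex-≤ {t} {a} {b} {c} 0≤1-t 0≤t a≤c b≤c = excess
    ((1ℚ - t) * (c - a) + t * (c - b))
    (convex-nonneg 0≤1-t 0≤t (p≤q⇒0≤q-p a≤c) (p≤q⇒0≤q-p b≤c))
    (solve 4 (λ t a b c → c := (con 1ℚ :- t) :* a :+ t :* b :+
      ((con 1ℚ :- t) :* (c :- a) :+ t :* (c :- b))) refl t a b c)

  indicator : {𝒜 : Pred (Subset n) ℓ} → Decidable 𝒜 → Subset n → ℚ
  indicator 𝒜? A = if does (𝒜? A) then 1ℚ else 0ℚ

  indicator-nonneg : {𝒜 : Pred (Subset n) ℓ} (𝒜? : Decidable 𝒜) → ∀ A → 0ℚ ≤ indicator 𝒜? A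
  indicator-nonneg 𝒜? A with does (𝒜? A)
  ... | true  = 0≤1
  ... | false = ≤-refl

  indicator-≤1 : {𝒜 : Pred (Subset n) ℓ} (𝒜? : Decidable 𝒜) → ∀ A → indicator 𝒜? A ≤ 1ℚ
  indicator-≤1 𝒜? A with does (𝒜? A)
  ... | true  = ≤-refl
  ... | false = 0≤1

  -- 𝔼*ₚ(𝒜) ≥ 1, tested on rational covers of all small members of 𝒜 rather than
  -- of the minterms only, so that minterms need not be decided.
  UnitExpectation : ℚ → ℕ → Pred (Subset n) ℓ → Set ℓ
  UnitExpectation p k 𝒜 = ∀ β → (∀ S → 0ℚ ≤ β S) →
    (∀ {A} → 𝒜 A → ∣ A ∣ ℕ.≤ k → 1ℚ ≤ ∫ (below A) β) → 1ℚ ≤ ∫ (size p) β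

  -- Here `r` is `1 / q`, and `h` will be `1 / k`. Leaving `q` free, tied to `p` only through
  -- `(r - 1) * p ≤ h`, covers both `q = k p` and the truncated choice `q = 1`.
  module SecondMoment
    {n : ℕ} {ℓ : Level} {𝒜 : Pred (Subset n) ℓ} (𝒜? : Decidable 𝒜)
    (monotone : Monotone 𝒜) (k : ℕ)
    {p q r h : ℚ} (0≤q : 0ℚ ≤ q) (q≤1 : q ≤ 1ℚ) (rq≡1 : r * q ≡ 1ℚ) (1≤r : 1ℚ ≤ r)
    (0≤p : 0ℚ ≤ p) (0≤h : 0ℚ ≤ h) (rp≤h : (r - 1ℚ) * p ≤ h)
    where

    𝔼 : (Subset n → ℚ) → ℚ
    𝔼 = ∫ (bernoulli q)

    D c : ℚ
    D = r ^ n
    c = (1ℚ + h) ^ k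

    -- X is a convex combination of the upDensity r B, B ∈ 𝒜 with ∣ B ∣ ≤ k,
    -- and β is the same combination of the coverWeight r B.
    record Mixture (X β : Subset n → ℚ) : Set ℓ where
      field
        nonneg  : ∀ R → 0ℚ ≤ X R
        bounded : ∀ R → X R ≤ D
        support : ∀ R → 𝒜 R ⊎ X R ≡ 0ℚ
        mean    : 𝔼 X ≡ 1ℚ
        nonnegβ : ∀ S → 0ℚ ≤ β S
        covered : ∀ A → 𝔼 (λ R → X R * upDensity r A R) ≡ ∫ (below A) β
        cheap   : ∫ (size p) β ≤ c

    open Mixture

    pure : ∀ {B} → 𝒜 B → ∣ B ∣ ℕ.≤ k → Mixture (upDensity r B) (coverWeight r B)
    pure {B} B∈𝒜 ∣B∣≤k = record
      { nonneg  = upDensity-nonneg (≤-trans 0≤1 1≤r) B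
      ; bounded = upDensity-≤ 1≤r B
      ; support = λ R → map₁ (monotone B∈𝒜) (upDensity-support r B R)
      ; mean    = upDensity-mean rq≡1 B
      ; nonnegβ = coverWeight-nonneg 1≤r B
      ; covered = λ A → correlation rq≡1 A B
      ; cheap   = subst (_≤ c) (sym (coverWeight-cost r p B)) (≤-trans
          (^-monoˡ (+-nonneg 0≤1 (*-nonneg (p≤q⇒0≤q-p 1≤r) 0≤p)) (+-monoʳ-≤ 1ℚ rp≤h) ∣ B ∣)
          (^-monoʳ (1≤1+nonneg 0≤h) ∣B∣≤k))
      }

    mix : ∀ {t X β Y γ} → 0ℚ ≤ t → t ≤ 1ℚ → Mixture X β → Mixture Y γ →
      Mixture (λ R → (1ℚ - t) * X R + t * Y R) (λ S → (1ℚ - t) * β S + t * γ S)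
    mix {t} {X} {β} {Y} {γ} 0≤t t≤1 x y = record
      { nonneg  = λ R → convex-nonneg 0≤1-t 0≤t (nonneg x R) (nonneg y R)
      ; bounded = λ R → convex-≤ 0≤1-t 0≤t (bounded x R) (bounded y R)
      ; support = support′
      ; mean    = trans (∫-linear (bernoulli q) (1ℚ - t) X t Y)
          (trans (cong₂ (λ u v → (1ℚ - t) * u + t * v) (mean x) (mean y))
            (solve 1 (λ t → (con 1ℚ :- t) :* con 1ℚ :+ t :* con 1ℚ := con 1ℚ) refl t))
      ; nonnegβ = λ S → convex-nonneg 0≤1-t 0≤t (nonnegβ x S) (nonnegβ y S)
      ; covered = λ A → trans
          (∫-cong (bernoulli q) (λ R →
            solve 4 (λ t x y u → ((con 1ℚ :- t) :* x :+ t :* y) :* u :=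
              (con 1ℚ :- t) :* (x :* u) :+ t :* (y :* u)) refl t (X R) (Y R) (upDensity r A R)))
          (trans (∫-linear (bernoulli q) (1ℚ - t) (λ R → X R * upDensity r A R)
                    t (λ R → Y R * upDensity r A R))
            (trans (cong₂ (λ u v → (1ℚ - t) * u + t * v) (covered x A) (covered y A))
              (sym (∫-linear (below A) (1ℚ - t) β t γ))))
      ; cheap   = subst (_≤ c) (sym (∫-linear (size p) (1ℚ - t) β t γ))
          (convex-≤ 0≤1-t 0≤t (cheap x) (cheap y))
      }
      where
      0≤1-t : 0ℚ ≤ 1ℚ - t
      0≤1-t = p≤q⇒0≤q-p t≤1
      support′ : ∀ R → 𝒜 R ⊎ (1ℚ - t) * X R + t * Y R ≡ 0ℚ
      support′ R with support x R | support y R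
      ... | inj₁ R∈𝒜 | _        = inj₁ R∈𝒜
      ... | inj₂ _   | inj₁ R∈𝒜 = inj₁ R∈𝒜
      ... | inj₂ X≡0 | inj₂ Y≡0 = inj₂ (trans
        (cong₂ (λ u v → (1ℚ - t) * u + t * v) X≡0 Y≡0)
        (solve 1 (λ t → (con 1ℚ :- t) :* con 0ℚ :+ t :* con 0ℚ := con 0ℚ) refl t))

    ⟨_,_⟩ : (Subset n → ℚ) → (Subset n → ℚ) → ℚ
    ⟨ X , Y ⟩ = 𝔼 λ R → X R * Y R

    inner-nonneg : ∀ {X β Y γ} → Mixture X β → Mixture Y γ → 0ℚ ≤ ⟨ X , Y ⟩
    inner-nonneg x y = expectation-0≤ 0≤q q≤1 λ R → *-nonneg (nonneg x R) (nonneg y R)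

    -- Pointwise `X * X ≤ D * X`, and `X` has mean 1.
    norm-≤ : ∀ {X β} → Mixture X β → ⟨ X , X ⟩ ≤ D
    norm-≤ {X} x = subst (⟨ X , X ⟩ ≤_)
      (trans (∫-scale (bernoulli q) D X) (trans (cong (D *_) (mean x)) (*-identityʳ D)))
      (∫-mono (bernoulli-nonneg n 0≤q q≤1) λ R →
        *-monoʳ-≤-nonNeg (X R) {{nonNegative (nonneg x R)}} (bounded x R))

    norm-mix : ∀ t X Y → ⟨ (λ R → (1ℚ - t) * X R + t * Y R) , (λ R → (1ℚ - t) * X R + t * Y R) ⟩ ≡
      (1ℚ - t) * ((1ℚ - t) * ⟨ X , X ⟩ + t * ⟨ X , Y ⟩) + t * ((1ℚ - t) * ⟨ X , Y ⟩ + t * ⟨ Y , Y ⟩)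
    norm-mix t X Y = trans
      (∫-cong (bernoulli q) λ R → solve 3 (λ t x y →
        ((con 1ℚ :- t) :* x :+ t :* y) :* ((con 1ℚ :- t) :* x :+ t :* y) :=
        (con 1ℚ :- t) :* ((con 1ℚ :- t) :* (x :* x) :+ t :* (x :* y)) :+
        t :* ((con 1ℚ :- t) :* (x :* y) :+ t :* (y :* y))) refl t (X R) (Y R))
      (trans (∫-linear (bernoulli q) (1ℚ - t) (λ R → (1ℚ - t) * (X R * X R) + t * (X R * Y R))
                t (λ R → (1ℚ - t) * (X R * Y R) + t * (Y R * Y R)))
        (cong₂ (λ u v → (1ℚ - t) * u + t * v)
          (∫-linear (bernoulli q) (1ℚ - t) (λ R → X R * X R) t (λ R → X R * Y R))
          (∫-linear (bernoulli q) (1ℚ - t) (λ R → X R * Y R) t (λ R → Y R * Y R))))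

    -- First-order optimality up to `ε` for minimising `⟨ X , X ⟩` over mixtures: moving towards any
    -- `upDensity r A` has slope at least `- 2 ε`.
    Stationary : ℚ → (Subset n → ℚ) → Set ℓ
    Stationary ε X = ∀ {A} → 𝒜 A → ∣ A ∣ ℕ.≤ k → ⟨ X , X ⟩ - ε ≤ ⟨ X , upDensity r A ⟩

    -- Frank–Wolfe descent on ⟨ X , X ⟩: while X is not stationary, mixing in a
    -- violated upDensity with weight t decreases ⟨ X , X ⟩ by t * ε.
    descent : ∀ {t ε} → 0ℚ ≤ t → t ≤ 1ℚ → ε ≡ D * t + D * t → ∀ m {X β} → Mixture X β →
      ⟨ X , X ⟩ ≤ ι m * (t * ε) →
      ∃[ X ] ∃[ β ] (Mixture X β × Stationary ε X)
    -- With the budget used up, `⟨ X , X ⟩ ≤ 0`, so stationarity follows from the nonnegativity of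
    -- the inner products.
    descent {t} {ε} 0≤t t≤1 ε≡ zero {X} {β} x XX≤ = X , β , x , λ {A} A∈𝒜 ∣A∣≤k → ≤-trans
      (subst (⟨ X , X ⟩ - ε ≤_) (lem (t * ε)) (+-mono-≤ XX≤ (neg-antimono-≤ 0≤ε)))
      (inner-nonneg x (pure A∈𝒜 ∣A∣≤k))
      where
      0≤D : 0ℚ ≤ D
      0≤D = ≤-trans 0≤1 (1≤x^m 1≤r n)
      0≤ε : 0ℚ ≤ ε
      0≤ε = subst (0ℚ ≤_) (sym ε≡) (+-nonneg (*-nonneg 0≤D 0≤t) (*-nonneg 0≤D 0≤t))
      lem : ∀ y → ι 0 * y - 0ℚ ≡ 0ℚ
      lem = solve 1 (λ y → con 0ℚ :* y :- con 0ℚ := con 0ℚ) refl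
    descent {t} {ε} 0≤t t≤1 ε≡ (suc m) {X} {β} x XX≤
      with anySubset? (λ A → 𝒜? A ×-dec (∣ A ∣ ℕ.≤? k) ×-dec
             (⟨ X , upDensity r A ⟩ <? ⟨ X , X ⟩ - ε))
    ... | no none = X , β , x , λ A∈𝒜 ∣A∣≤k → ≮⇒≥ λ lt → none (_ , A∈𝒜 , ∣A∣≤k , lt)
    ... | yes (A , A∈𝒜 , ∣A∣≤k , L<Q-ε) = descent 0≤t t≤1 ε≡ m (mix 0≤t t≤1 x y)
      (subst (_≤ ι m * (t * ε)) (sym (norm-mix t X Y))
        (≤-trans step (subst (Q - t * ε ≤_) (lem (ι m) (t * ε))
          (+-monoˡ-≤ (- (t * ε)) (subst (λ z → Q ≤ z * (t * ε)) (ι-suc m) XX≤)))))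
      where
      Y = upDensity r A
      y = pure A∈𝒜 ∣A∣≤k
      Q = ⟨ X , X ⟩
      L = ⟨ X , Y ⟩
      S = ⟨ Y , Y ⟩
      lem : ∀ i x → (1ℚ + i) * x - x ≡ i * x
      lem = solve 2 (λ i x → (con 1ℚ :+ i) :* x :- x := i :* x) refl
      -- The new norm is `Q - 2 t (Q - L) + t² (Q - 2 L + S)`. A violation means `Q - L > ε`, so the
      -- linear term gains at least `2 t ε`; the quadratic term costs at most `2 D t²`, which is
      -- `t ε` by the choice of `ε`.
      step : (1ℚ - t) * ((1ℚ - t) * Q + t * L) + t * ((1ℚ - t) * L + t * S) ≤ Q - t * ε
      step = excess
        ((t + t) * (Q - ε - L) + t * t * ((D - Q) + (D - S) + (L + L)))
        (+-nonneg (*-nonneg (+-nonneg 0≤t 0≤t) (p≤q⇒0≤q-p (<⇒≤ L<Q-ε)))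
          (*-nonneg (square-nonneg t) (+-nonneg (+-nonneg
            (p≤q⇒0≤q-p (norm-≤ x)) (p≤q⇒0≤q-p (norm-≤ y)))
            (+-nonneg (inner-nonneg x y) (inner-nonneg x y)))))
        (trans (cong (λ ε → Q - t * ε) ε≡) (trans (lem₁ t Q L S D)
          (cong (λ ε → (1ℚ - t) * ((1ℚ - t) * Q + t * L) + t * ((1ℚ - t) * L + t * S)
            + ((t + t) * (Q - ε - L) + t * t * ((D - Q) + (D - S) + (L + L)))) (sym ε≡))))
        where
        lem₁ : ∀ t Q L S D → Q - t * (D * t + D * t) ≡
          (1ℚ - t) * ((1ℚ - t) * Q + t * L) + t * ((1ℚ - t) * L + t * S)
          + ((t + t) * (Q - (D * t + D * t) - L) + t * t * ((D - Q) + (D - S) + (L + L)))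
        lem₁ = solve 5 (λ t Q L S D → Q :- t :* (D :* t :+ D :* t) :=
          (con 1ℚ :- t) :* ((con 1ℚ :- t) :* Q :+ t :* L) :+ t :* ((con 1ℚ :- t) :* L :+ t :* S)
          :+ ((t :+ t) :* (Q :- (D :* t :+ D :* t) :- L) :+ t :* t :* ((D :- Q) :+ (D :- S) :+ (L :+ L)))) refl

    𝟙 : Subset n → ℚ
    𝟙 = indicator 𝒜?

    -- 𝔼 (X - s 𝟙)² ≥ 0; the choice s = ⟨ X , X ⟩ would give Cauchy–Schwarz.
    second-moment : ∀ {X β} → Mixture X β → ∀ s → s + s ≤ ⟨ X , X ⟩ + s * s * 𝔼 𝟙
    second-moment {X} x s = subst₂ _≤_
      (trans (∫-scale (bernoulli q) (s + s) X) (trans (cong ((s + s) *_) (mean x)) (*-identityʳ (s + s))))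
      (trans (∫-linear (bernoulli q) 1ℚ (λ R → X R * X R) (s * s) 𝟙) (cong (_+ s * s * 𝔼 𝟙) (*-identityˡ ⟨ X , X ⟩)))
      (∫-mono (bernoulli-nonneg n 0≤q q≤1) pointwise)
      where
      pointwise : ∀ R → (s + s) * X R ≤ 1ℚ * (X R * X R) + s * s * 𝟙 R
      pointwise R with 𝒜? R | support x R
      ... | yes _  | _ = excess ((X R - s) * (X R - s)) (square-nonneg (X R - s))
        (solve 2 (λ s x → con 1ℚ :* (x :* x) :+ s :* s :* con 1ℚ :=
                   (s :+ s) :* x :+ (x :- s) :* (x :- s)) refl s (X R))
      ... | no R∉𝒜 | inj₁ R∈𝒜 = contradiction R∈𝒜 R∉𝒜
      -- Off `𝒜` both `X` and `𝟙` vanish.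
      ... | no _   | inj₂ X≡0 rewrite X≡0 = ≤-reflexive
        (solve 1 (λ s → (s :+ s) :* con 0ℚ :=
                   con 1ℚ :* (con 0ℚ :* con 0ℚ) :+ s :* s :* con 0ℚ) refl s)

    module _ (expectation : UnitExpectation p k 𝒜) where

      -- For positive `v` the hypothesis is applied to `β / v`. The sign of `v` is left open because
      -- `v` will be `⟨ X , X ⟩ - ε`.
      expectation-homogeneous : ∀ {β v} → (∀ S → 0ℚ ≤ β S) →
        (∀ {A} → 𝒜 A → ∣ A ∣ ℕ.≤ k → v ≤ ∫ (below A) β) → v ≤ ∫ (size p) β
      expectation-homogeneous {β} {v} 0≤β covers with v ≤? 0ℚ
      ... | yes v≤0 = ≤-trans v≤0 (∫-nonneg (size-nonneg n 0≤p) 0≤β)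
      ... | no  v≰0 with inverse (≰⇒> v≰0)
      ... | w , 0<w , wv≡1 = *-cancelˡ-≤-pos w {{positive 0<w}}
        (subst₂ _≤_ (sym wv≡1) (∫-scale (size p) w β)
          (expectation (λ S → w * β S) (λ S → *-nonneg (<⇒≤ 0<w) (0≤β S))
            (λ {A} A∈𝒜 ∣A∣≤k → subst₂ _≤_ wv≡1 (sym (∫-scale (below A) w β))
              (*-monoˡ-≤-nonNeg w {{nonNegative (<⇒≤ 0<w)}} (covers A∈𝒜 ∣A∣≤k)))))

      -- Otherwise the zero function would vacuously be a cover, of cost 0. The member found is the
      -- starting point of the descent.
      small-member : ∃[ A ] (𝒜 A × ∣ A ∣ ℕ.≤ k)
      small-member with anySubset? (λ A → 𝒜? A ×-dec (∣ A ∣ ℕ.≤? k))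
      ... | yes A = A
      ... | no none = contradiction
        (expectation (λ _ → 0ℚ) (λ _ → ≤-refl) (λ A∈𝒜 ∣A∣≤k → contradiction (_ , A∈𝒜 , ∣A∣≤k) none))
        (λ 1≤∫ → <-irrefl refl (<-≤-trans (positive⁻¹ 1ℚ) (subst (1ℚ ≤_) (∫-zero (size {n} p)) 1≤∫)))

      0≤D : 0ℚ ≤ D
      0≤D = ≤-trans 0≤1 (1≤x^m 1≤r n)

      -- By `covered`, stationarity says that `β` sums to at least `Q - ε` below every small member.
      -- Hence `Q - ε ≤ c ≤ s - ε`, that is `Q ≤ s`. Then `second-moment` gives `2 s ≤ s + s² 𝔼 𝟙`,
      -- and `s` cancels.
      stationary⇒bound : ∀ {ε s X β} → 0ℚ < s → c ≤ s - ε → Mixture X β →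
        Stationary ε X → 1ℚ ≤ s * 𝔼 𝟙
      stationary⇒bound {ε} {s} {X} {β} 0<s c≤s-ε x stationary =
        *-cancelˡ-≤-pos s {{positive 0<s}}
          (excess (s - ε - (Q - ε) + (Q + s * s * 𝔼 𝟙 - (s + s)))
            (+-nonneg (p≤q⇒0≤q-p (≤-trans Q-ε≤c c≤s-ε)) (p≤q⇒0≤q-p (second-moment x s)))
            (lem s Q ε (𝔼 𝟙)))
        where
        Q = ⟨ X , X ⟩
        Q-ε≤c : Q - ε ≤ c
        Q-ε≤c = ≤-trans
          (expectation-homogeneous (nonnegβ x) (λ {A} A∈𝒜 ∣A∣≤k →
            subst (Q - ε ≤_) (covered x A) (stationary A∈𝒜 ∣A∣≤k)))
          (cheap x)
        lem : ∀ s Q ε m → s * (s * m) ≡ s * 1ℚ + (s - ε - (Q - ε) + (Q + s * s * m - (s + s)))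
        lem = solve 4 (λ s Q ε m → s :* (s :* m) :=
          s :* con 1ℚ :+ (s :- ε :- (Q :- ε) :+ (Q :+ s :* s :* m :- (s :+ s)))) refl

      approximate-bound : ∀ {t ε s} → 0ℚ < t → t ≤ 1ℚ → ε ≡ D * t + D * t → 0ℚ < ε →
        0ℚ < s → c ≤ s - ε → 1ℚ ≤ s * 𝔼 𝟙
      approximate-bound {t} {ε} {s} 0<t t≤1 ε≡ 0<ε 0<s c≤s-ε = from small-member
        where
        from : ∃[ A ] (𝒜 A × ∣ A ∣ ℕ.≤ k) → 1ℚ ≤ s * 𝔼 𝟙
        from (A , A∈𝒜 , ∣A∣≤k) =
          let x = pure A∈𝒜 ∣A∣≤k
              -- Enough descent steps: the initial norm is at most `D`, and each step lowers it by
              -- at least `t * ε`.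
              m , D≤mtε = archimedean-multiple D (*-pos 0<t 0<ε)
              X , β , y , stationary = descent (<⇒≤ 0<t) t≤1 ε≡ m x (≤-trans (norm-≤ x) D≤mtε)
          in stationary⇒bound 0<s c≤s-ε y stationary

      measure-bound : 1ℚ ≤ c * 𝔼 𝟙
      measure-bound = ≤-limit λ ε 0<ε → from ε (small-multiple (+-nonneg 0≤D 0≤D) 0<ε)
        where
        0<D : 0ℚ < D
        0<D = <-≤-trans (positive⁻¹ 1ℚ) (1≤x^m 1≤r n)
        0≤c : 0ℚ ≤ c
        0≤c = ^-nonneg (+-nonneg 0≤1 0≤h) k
        from : ∀ ε → ∃[ t ] (0ℚ < t × t ≤ 1ℚ × (D + D) * t < ε) → 1ℚ ≤ c * 𝔼 𝟙 + ε
        from ε (t , 0<t , t≤1 , δ<ε) = begin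
          -- The tolerance of stationarity is `δ = 2 D t` and `s = c + δ`; since `𝔼 𝟙 ≤ 1`, the
          -- error is at most `δ`, which is below `ε`.
          1ℚ                    ≤⟨ approximate-bound 0<t t≤1 (*-distribʳ-+ t D D) 0<δ
                                     (+-mono-≤-< 0≤c 0<δ)
                                     (≤-reflexive (lem₁ c δ)) ⟩
          (c + δ) * 𝔼 𝟙         ≡⟨ *-distribʳ-+ (𝔼 𝟙) c δ ⟩
          c * 𝔼 𝟙 + δ * 𝔼 𝟙     ≤⟨ +-monoʳ-≤ (c * 𝔼 𝟙)
                                     (*-monoˡ-≤-nonNeg δ {{nonNegative (<⇒≤ 0<δ)}}
                                       (expectation-≤ 0≤q q≤1 (indicator-≤1 𝒜?))) ⟩
          c * 𝔼 𝟙 + δ * 1ℚ      ≡⟨ cong (c * 𝔼 𝟙 +_) (*-identityʳ δ) ⟩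
          c * 𝔼 𝟙 + δ           ≤⟨ +-monoʳ-≤ (c * 𝔼 𝟙) (<⇒≤ δ<ε) ⟩
          c * 𝔼 𝟙 + ε ∎
          where
          open ≤-Reasoning
          δ = (D + D) * t
          0<δ : 0ℚ < δ
          0<δ = *-pos (+-mono-< 0<D 0<D) 0<t
          lem₁ : ∀ c δ → c ≡ c + δ - δ
          lem₁ = solve 2 (λ c δ → c := c :+ δ :- δ) refl

  -- Terms of the real quantities as rational integrals.

  seq-∑ : ∀ (ω : Weights n) (g : Subset n → ℝ) f c m →
    (∀ S → seq (g S) m ≡ c * (mass ω S * f S)) → seq (∑ g) m ≡ c * ∫ ω f
  seq-∑ []            g f c m eq = trans (eq []) (cong (c *_) (*-identityˡ (f [])))
  seq-∑ ((a , b) ∷ ω) g f c m eq = trans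
    (cong₂ _+_
      -- The scalar accumulates the factors of the coordinates already split off, which is why the
      -- lemma is stated with a general `c`.
      (seq-∑ ω (g ∘ (outside ∷_)) (f ∘ (outside ∷_)) (c * a) m
        λ S → trans (eq (outside ∷ S)) (lem₁ c a (mass ω S) (f (outside ∷ S))))
      (seq-∑ ω (g ∘ (inside ∷_)) (f ∘ (inside ∷_)) (c * b) m
        λ S → trans (eq (inside ∷ S)) (lem₁ c b (mass ω S) (f (inside ∷ S)))))
    (solve 5 (λ a b c x y → c :* a :* x :+ c :* b :* y := c :* (a :* x :+ b :* y)) refl
      a b c (∫ ω (f ∘ (outside ∷_))) (∫ ω (f ∘ (inside ∷_))))
    where
    lem₁ : ∀ c a x y → c * (a * x * y) ≡ c * a * (x * y)
    lem₁ = solve 4 (λ c a x y → c :* (a :* x :* y) := c :* a :* (x :* y)) refl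

  seq-∑≡∫ : ∀ (ω : Weights n) (g : Subset n → ℝ) f m →
    (∀ S → seq (g S) m ≡ mass ω S * f S) → seq (∑ g) m ≡ ∫ ω f
  seq-∑≡∫ ω g f m eq = trans
    (seq-∑ ω g f 1ℚ m λ S → trans (eq S) (sym (*-identityˡ (mass ω S * f S))))
    (*-identityˡ (∫ ω f))

  mass-bernoulli : ∀ x m (A : Subset n) → seq (weight x A) m ≡ mass (bernoulli (seq x m)) A
  mass-bernoulli x m []            = refl
  mass-bernoulli x m (outside ∷ A) = cong ((1ℚ - seq x m) *_) (mass-bernoulli x m A)
  mass-bernoulli x m (inside  ∷ A) = cong (seq x m *_) (mass-bernoulli x m A)

  mass-size : ∀ x m (S : Subset n) → seq (x ℝ.^ ∣ S ∣) m ≡ mass (size (seq x m)) S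
  mass-size x m []            = refl
  mass-size x m (outside ∷ S) = trans (mass-size x m S) (sym (*-identityˡ (mass (size (seq x m)) S)))
  mass-size x m (inside  ∷ S) = cong (seq x m *_) (mass-size x m S)

  mass-below : ∀ (A S : Subset n) → mass (below A) S ≡ (if does (S ⊆? A) then 1ℚ else 0ℚ)
  mass-below []            []            = refl
  mass-below (a       ∷ A) (outside ∷ S) = trans (*-identityˡ (mass (below A) S)) (mass-below A S)
  mass-below (inside  ∷ A) (inside  ∷ S) = trans (*-identityˡ (mass (below A) S)) (mass-below A S)
  mass-below (outside ∷ A) (inside  ∷ S) = *-zeroˡ (mass (below A) S)

  seq-if : ∀ b x m → seq (if b then x else 0ℝ) m ≡ seq x m * (if b then 1ℚ else 0ℚ)
  seq-if true  x m = sym (*-identityʳ (seq x m))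
  seq-if false x m = sym (*-zeroʳ (seq x m))

  seq-μ : ∀ x {𝒜 : Pred (Subset n) ℓ} (𝒜? : Decidable 𝒜) m →
    seq (μ x 𝒜?) m ≡ ∫ (bernoulli (seq x m)) (indicator 𝒜?)
  seq-μ x 𝒜? m = seq-∑≡∫ (bernoulli (seq x m)) _ (indicator 𝒜?) m λ S →
    trans (seq-if (does (𝒜? S)) (weight x S) m)
      (cong (_* indicator 𝒜? S) (mass-bernoulli x m S))

  seq-cost : ∀ x (β : Subset n → ℚ) m → seq (cost x (fromℚ ∘ β)) m ≡ ∫ (size (seq x m)) β
  seq-cost x β m = seq-∑≡∫ (size (seq x m)) _ β m λ S →
    trans (cong (β S *_) (mass-size x m S)) (*-comm (β S) (mass (size (seq x m)) S))

  seq-below : ∀ (A : Subset n) (β : Subset n → ℚ) m →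
    seq (∑[ _⊆? A ] (fromℚ ∘ β)) m ≡ ∫ (below A) β
  seq-below A β m = seq-∑≡∫ (below A) _ β m λ S →
    trans (seq-if (does (S ⊆? A)) (fromℚ (β S)) m)
      (trans (*-comm (β S) (if does (S ⊆? A) then 1ℚ else 0ℚ)) (cong (_* β S) (sym (mass-below A S))))

  -- Rational approximation of p and passage to the limit.

  ∣∫-size∣≤ : ∀ {x y} → ℚ.∣ x ∣ ≤ y → {β : Subset n → ℚ} → (∀ S → 0ℚ ≤ β S) →
    ℚ.∣ ∫ (size x) β ∣ ≤ ∫ (size y) β
  ∣∫-size∣≤ {zero}          ∣x∣≤y {β} 0≤β = ≤-reflexive (0≤p⇒∣p∣≡p (0≤β []))
  ∣∫-size∣≤ {suc n} {x} {y} ∣x∣≤y {β} 0≤β = ≤-trans (∣p+q∣≤∣p∣+∣q∣ (1ℚ * I₀) (x * I₁))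
    (+-mono-≤
      (∣p*q∣≤ 1ℚ I₀ ≤-refl (∣∫-size∣≤ ∣x∣≤y (0≤β ∘ (outside ∷_))))
      (∣p*q∣≤ x I₁ ∣x∣≤y (∣∫-size∣≤ ∣x∣≤y (0≤β ∘ (inside ∷_)))))
    where
    I₀ = ∫ (size x) (β ∘ (outside ∷_))
    I₁ = ∫ (size x) (β ∘ (inside ∷_))

  -- A rational cover of the small members covers all minterms, so its cost at `p` is at least 1.
  -- The cost at `p′` dominates, since `p′` bounds the late terms of `p` in absolute value; absolute
  -- values account for terms that are negative.
  rational-expectation : ∀ {k} {𝒜 : Pred (Subset n) ℓ} →
    (∀ {A} → IsMinterm 𝒜 A → ∣ A ∣ ℕ.≤ k) → ∀ {p} → Is𝔼* p 𝒜 1ℝ →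
    ∀ {p′} N → (∀ m → N ℕ.≤ m → ℚ.∣ seq p m ∣ ≤ p′) → UnitExpectation p′ k 𝒜
  rational-expectation minterms≤k {p} 𝔼*≡1 {p′} N ∣p∣≤p′ β 0≤β covers = ≤-limit λ ε 0<ε →
    let M , 1≤cost+ε = Is𝔼*.lowerBound 𝔼*≡1 (fromℚ ∘ β) cover ε 0<ε
        m = M ℕ.⊔ N
    in ≤-trans (subst (λ z → 1ℚ ≤ z + ε) (seq-cost p β m) (1≤cost+ε m (ℕ.m≤m⊔n M N)))
         (+-monoˡ-≤ ε (≤-trans (p≤∣p∣ (∫ (size (seq p m)) β))
           (∣∫-size∣≤ (∣p∣≤p′ m (ℕ.m≤n⊔m M N)) 0≤β)))
    where
    cover : IsFractionalCover _ (fromℚ ∘ β)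
    cover = record
      { nonNegative = λ B ε 0<ε → 0 , λ _ _ → +-nonneg (0≤β B) (<⇒≤ 0<ε)
      ; covers      = λ {A} minterm ε 0<ε → 0 , λ m _ →
          subst (λ z → 1ℚ ≤ z + ε) (sym (seq-below A β m))
            (≤-trans (covers (proj₁ minterm) (minterms≤k minterm))
              (excess ε (<⇒≤ 0<ε) refl))
      }

  -- The conditions on `q` say that it is the minimum of 1 and `ι k * p`; `p` will be a slightly
  -- enlarged rational, so `ι k * p` may exceed 1. In that case `r = 1` and `(r - 1) * p = 0`.
  -- Otherwise `r * (k p) = 1` and `h k = 1` give `h = r * p`, which exceeds `(r - 1) * p` by `p`.
  rational-bound : ∀ {k} {𝒜 : Pred (Subset n) ℓ} (𝒜? : Decidable 𝒜) → Monotone 𝒜 →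
    ∀ {h} → 0ℚ ≤ h → h * ι k ≡ 1ℚ → 0ℚ < ι k → ∀ {p} → 0ℚ < p → UnitExpectation p k 𝒜 →
    ∃[ q ] (0ℚ ≤ q × q ≤ 1ℚ × q ≤ ι k * p × (ι k * p ≤ q ⊎ 1ℚ ≤ q) ×
      1ℚ ≤ (1ℚ + h) ^ k * ∫ (bernoulli q) (indicator 𝒜?))
  rational-bound {k = k} 𝒜? mono {h} 0≤h hk≡1 0<k {p} 0<p unit with ≤-total (ι k * p) 1ℚ
  ... | inj₂ 1≤kp = 1ℚ , 0≤1 , ≤-refl , 1≤kp , inj₂ ≤-refl ,
    SecondMoment.measure-bound 𝒜? mono k {p} {1ℚ} {1ℚ} {h} 0≤1 ≤-refl (*-identityˡ 1ℚ) ≤-refl (<⇒≤ 0<p) 0≤h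
      (subst (_≤ h) (sym (*-zeroˡ p)) 0≤h) unit
  ... | inj₁ kp≤1 =
    let q = ι k * p
        0<q : 0ℚ < q
        0<q = *-pos 0<k 0<p
        r , 0<r , rq≡1 = inverse 0<q
        1≤r : 1ℚ ≤ r
        1≤r = inverse-antimono-≤ 0<q (positive⁻¹ 1ℚ) rq≡1 (*-identityˡ 1ℚ) kp≤1
        lem : h ≡ (r - 1ℚ) * p + p
        lem = trans (sym (*-identityʳ h)) (trans (cong (h *_) (sym rq≡1))
          (trans (solve 4 (λ h r k p → h :* (r :* (k :* p)) := (h :* k) :* (r :* p)) refl h r (ι k) p)
          (trans (cong (_* (r * p)) hk≡1)
            (solve 2 (λ r p → con 1ℚ :* (r :* p) := (r :- con 1ℚ) :* p :+ p) refl r p))))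
    in q , <⇒≤ 0<q , kp≤1 , ≤-refl , inj₁ ≤-refl ,
      SecondMoment.measure-bound 𝒜? mono k {p} {q} {r} {h} (<⇒≤ 0<q) kp≤1 rq≡1 1≤r (<⇒≤ 0<p) 0≤h
        (excess p (<⇒≤ 0<p) lem) unit

  -- Used with `κ = k`, `a` a late term of `p`, `b` its enlargement `p′` and `q` the minimum of 1
  -- and `κ * b`. The truncation at 1 is harmless because `κ * a` exceeds 1 by at most `η`.
  close : ∀ {κ a b q δ η} → 0ℚ ≤ κ → 0ℚ ≤ η → a ≤ b → b - a ≤ δ → κ * δ ≤ η → κ * a ≤ 1ℚ + η →
    q ≤ κ * b → (κ * b ≤ q ⊎ 1ℚ ≤ q) → ℚ.∣ κ * a - q ∣ ≤ η
  close {κ} {a} {b} {q} {δ} {η} 0≤κ 0≤η a≤b b-a≤δ κδ≤η κa≤1+η q≤κb q≥ = ∣p∣≤ (upper q≥)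
    (≤-trans (excess (κ * b - q + κ * (δ - (b - a)))
        (+-nonneg (p≤q⇒0≤q-p q≤κb) (*-nonneg 0≤κ (p≤q⇒0≤q-p b-a≤δ)))
        (solve 5 (λ κ a b q δ → κ :* δ := (:- (κ :* a :- q)) :+ (κ :* b :- q :+ κ :* (δ :- (b :- a)))) refl κ a b q δ))
      κδ≤η)
    where
    upper : κ * b ≤ q ⊎ 1ℚ ≤ q → κ * a - q ≤ η
    upper (inj₁ κb≤q) = excess (η + (q - κ * b) + κ * (b - a))
      (+-nonneg (+-nonneg 0≤η (p≤q⇒0≤q-p κb≤q)) (*-nonneg 0≤κ (p≤q⇒0≤q-p a≤b)))
      (solve 5 (λ κ a b q η → η := κ :* a :- q :+ (η :+ (q :- κ :* b) :+ κ :* (b :- a))) refl κ a b q η)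
    upper (inj₂ 1≤q) = excess (1ℚ + η - κ * a + (q - 1ℚ))
      (+-nonneg (p≤q⇒0≤q-p κa≤1+η) (p≤q⇒0≤q-p 1≤q))
      (solve 4 (λ κ a q η → η := κ :* a :- q :+ (con 1ℚ :+ η :- κ :* a :+ (q :- con 1ℚ))) refl κ a q η)

  within-δ : ∀ {x y δ} → x - y ≤ δ → 0ℚ ≤ δ → x ≤ y + (δ + δ)
  within-δ {x} {y} {δ} x-y≤δ 0≤δ = excess (δ - (x - y) + δ)
    (+-nonneg (p≤q⇒0≤q-p x-y≤δ) 0≤δ)
    (solve 3 (λ x y δ → y :+ (δ :+ δ) := x :+ (δ :- (x :- y) :+ δ)) refl x y δ)

  within-3δ : ∀ {x y δ} → y - x ≤ δ → y + (δ + δ) - x ≤ δ + δ + δ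
  within-3δ {x} {y} {δ} y-x≤δ = excess (δ - (y - x)) (p≤q⇒0≤q-p y-x≤δ)
    (solve 3 (λ x y δ → δ :+ δ :+ δ := y :+ (δ :+ δ) :- x :+ (δ :- (y :- x))) refl x y δ)

  tripled : ∀ κ δ → (κ + κ + κ) * δ ≡ κ * (δ + δ + δ)
  tripled = solve 2 (λ κ δ → (κ :+ κ :+ κ) :* δ := κ :* (δ :+ δ :+ δ)) refl

  ∣p-q∣-comm : ∀ p q → ℚ.∣ p - q ∣ ≡ ℚ.∣ q - p ∣
  ∣p-q∣-comm p q = trans (sym (∣-p∣≡∣p∣ (p - q)))
    (cong ℚ.∣_∣ (solve 2 (λ p q → :- (p :- q) := q :- p) refl p q))

  -- Here `v = 1 / (1 + h) ^ k`. The bound holds exactly at a rational `q` within `η` of each late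
  -- term of `k p`, and `expectation-lipschitz` carries it over to that term with error below `ε`.
  measure-≥ : ∀ k .{{_ : NonZero k}} {𝒜 : Pred (Subset n) ℓ} (𝒜? : Decidable 𝒜) → Monotone 𝒜 →
    (∀ {A} → IsMinterm 𝒜 A → ∣ A ∣ ℕ.≤ k) →
    ∀ p → 0ℝ ℝ.≤ p → fromℕ k ℝ.* p ℝ.≤ 1ℝ → Is𝔼* p 𝒜 1ℝ →
    ∀ {h v} → 0ℚ ≤ h → h * ι k ≡ 1ℚ → 0ℚ < v → v * (1ℚ + h) ^ k ≡ 1ℚ →
    fromℚ v ℝ.≤ μ (fromℕ k ℝ.* p) 𝒜?
  measure-≥ {n} k {𝒜} 𝒜? mono minterms≤k p 0≤p kp≤1 𝔼*≡1 {h} {v} 0≤h hk≡1 0<v vc≡1 ε 0<ε =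
    choose-η (small-multiple (lipschitz-nonneg n) 0<ε)
    where
    μ-near : ℕ → Set
    μ-near m = v ≤ seq (μ (fromℕ k ℝ.* p) 𝒜?) m + ε

    bound : ∀ x y {z} → 1ℚ ≤ (1ℚ + h) ^ k * y → z < ε → ℚ.∣ x - y ∣ ≤ z → v ≤ x + ε
    bound x y {z} 1≤cy z<ε ∣x-y∣≤z = ≤-trans
      (subst₂ _≤_ (*-identityʳ v)
        (trans (sym (*-assoc v ((1ℚ + h) ^ k) y)) (trans (cong (_* y) vc≡1) (*-identityˡ y)))
        (*-monoˡ-≤-nonNeg v {{nonNegative (<⇒≤ 0<v)}} 1≤cy))
      (excess (z - (y - x) + (ε - z))
        (+-nonneg (p≤q⇒0≤q-p (≤-trans (p≤∣p∣ (y - x)) (subst (_≤ z) (∣p-q∣-comm x y) ∣x-y∣≤z)))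
          (p≤q⇒0≤q-p (<⇒≤ z<ε)))
        (solve 4 (λ x y z ε → x :+ ε := y :+ (z :- (y :- x) :+ (ε :- z))) refl x y z ε))

    choose-η : ∃[ η ] (0ℚ < η × η ≤ 1ℚ × lipschitz n * η < ε) → ℝ.Eventually μ-near
    choose-η (η , 0<η , η≤1 , Lη<ε) =
      -- The factor `3 k` comes from `p′ - seq p m ≤ 3 δ`, multiplied by `k`.
      choose-δ (small-multiple (+-nonneg (+-nonneg (0≤ι k) (0≤ι k)) (0≤ι k)) 0<η)
      where
      choose-δ : ∃[ δ ] (0ℚ < δ × δ ≤ 1ℚ × (ι k + ι k + ι k) * δ < η) → ℝ.Eventually μ-near
      choose-δ (δ , 0<δ , _ , 3kδ<η) =
        choose-N (ℝ.isCauchy p δ 0<δ) (0≤p δ 0<δ) (kp≤1 η 0<η)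
        where
        choose-N :
          ∃[ N ] (∀ m n → N ℕ.≤ m → N ℕ.≤ n → ℚ.∣ seq p m - seq p n ∣ < δ) →
          ℝ.Eventually (λ m → 0ℚ ≤ seq p m + δ) →
          ℝ.Eventually (λ m → ι k * seq p m ≤ 1ℚ + η) →
          ℝ.Eventually μ-near
        choose-N (N₁ , cauchy) (N₂ , 0≤p+δ) (N₃ , kp≤1+η) = N , λ m N≤m →
          near-m m N≤m (rational-bound 𝒜? mono 0≤h hk≡1 (0<ι k) (<-≤-trans 0<δ δ≤p′)
            (rational-expectation minterms≤k 𝔼*≡1 N ∣p∣≤p′))
          where
          N : ℕ
          N = N₁ ℕ.⊔ (N₂ ℕ.⊔ N₃)
          N₁≤ : ∀ {m} → N ℕ.≤ m → N₁ ℕ.≤ m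
          N₁≤ = ℕ.m⊔n≤o⇒m≤o N₁ (N₂ ℕ.⊔ N₃)
          N₂≤ : ∀ {m} → N ℕ.≤ m → N₂ ℕ.≤ m
          N₂≤ N≤m = ℕ.m⊔n≤o⇒m≤o N₂ N₃ (ℕ.m⊔n≤o⇒n≤o N₁ (N₂ ℕ.⊔ N₃) N≤m)
          N₃≤ : ∀ {m} → N ℕ.≤ m → N₃ ℕ.≤ m
          N₃≤ N≤m = ℕ.m⊔n≤o⇒n≤o N₂ N₃ (ℕ.m⊔n≤o⇒n≤o N₁ (N₂ ℕ.⊔ N₃) N≤m)
          p′ : ℚ
          -- One `δ` would already dominate the late terms. As `seq p N ≥ - δ`, the second gives
          -- `δ ≤ p′`, hence both `0 < p′` and `- seq p m ≤ δ ≤ p′`.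
          p′ = seq p N + (δ + δ)
          p≤p′ : ∀ m → N ℕ.≤ m → seq p m ≤ p′
          p≤p′ m N≤m = within-δ {seq p m}
            (≤-trans (p≤∣p∣ (seq p m - seq p N)) (<⇒≤ (cauchy m N (N₁≤ N≤m) (N₁≤ ℕ.≤-refl))))
            (<⇒≤ 0<δ)
          p′-p≤3δ : ∀ m → N ℕ.≤ m → p′ - seq p m ≤ δ + δ + δ
          p′-p≤3δ m N≤m = within-3δ {seq p m} {seq p N}
            (≤-trans (p≤∣p∣ (seq p N - seq p m)) (<⇒≤ (cauchy N m (N₁≤ ℕ.≤-refl) (N₁≤ N≤m))))
          δ≤p′ : δ ≤ p′
          δ≤p′ = excess (seq p N + δ) (0≤p+δ N (N₂≤ ℕ.≤-refl))
            (solve 2 (λ x δ → x :+ (δ :+ δ) := δ :+ (x :+ δ)) refl (seq p N) δ)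
          ∣p∣≤p′ : ∀ m → N ℕ.≤ m → ℚ.∣ seq p m ∣ ≤ p′
          ∣p∣≤p′ m N≤m = ∣p∣≤ (p≤p′ m N≤m) (≤-trans
            (excess (seq p m + δ) (0≤p+δ m (N₂≤ N≤m))
              (solve 2 (λ x δ → δ := (:- x) :+ (x :+ δ)) refl (seq p m) δ))
            δ≤p′)
          near-m : ∀ m → N ℕ.≤ m →
            ∃[ q ] (0ℚ ≤ q × q ≤ 1ℚ × q ≤ ι k * p′ × (ι k * p′ ≤ q ⊎ 1ℚ ≤ q) ×
              1ℚ ≤ (1ℚ + h) ^ k * ∫ (bernoulli q) (indicator 𝒜?)) → μ-near m
          near-m m N≤m (q , 0≤q , q≤1 , q≤kp′ , q≥ , 1≤cμ) =
            subst (λ z → v ≤ z + ε) (sym (seq-μ (fromℕ k ℝ.* p) 𝒜? m))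
              (bound (∫ (bernoulli (ι k * seq p m)) (indicator 𝒜?)) (∫ (bernoulli q) (indicator 𝒜?))
                1≤cμ Lη<ε
                (expectation-lipschitz n 0≤q q≤1 ∣kp-q∣≤η η≤1 (indicator-nonneg 𝒜?) (indicator-≤1 𝒜?)))
            where
            ∣kp-q∣≤η : ℚ.∣ ι k * seq p m - q ∣ ≤ η
            ∣kp-q∣≤η = close (0≤ι k) (<⇒≤ 0<η) (p≤p′ m N≤m) (p′-p≤3δ m N≤m)
              (subst (_≤ η) (tripled (ι k) δ) (<⇒≤ 3kδ<η)) (kp≤1+η m (N₃≤ N≤m)) q≤kp′ q≥

  -- Comparison with 1 / e and conclusion.

  1/e<rational : ∀ m {v x} → 0ℚ < x → v * x ≡ 1ℚ → x < ∑1/i! m → 1/e ℝ.< fromℚ v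
  1/e<rational m {v} {x} 0<x vx≡1 x<∑ = from (inverse 0<∑)
    where
    0<∑ : 0ℚ < ∑1/i! m
    0<∑ = <-trans 0<x x<∑
    0<∑i : ∀ {i} → m ℕ.≤ i → 0ℚ < ∑1/i! i
    0<∑i m≤i = <-≤-trans 0<∑ (∑1/i!-mono (ℕ.≤⇒≤′ m≤i))
    from : ∃[ w ] (0ℚ < w × w * ∑1/i! m ≡ 1ℚ) → 1/e ℝ.< fromℚ v
    -- The uniform gap is `v - w` with `w` the reciprocal of the partial sum up to `m`: later
    -- partial sums are larger, so their reciprocals stay at most `w`.
    from (w , _ , w∑≡1) = v - w ,
      p<q⇒0<q-p (inverse-antimono-< 0<x 0<∑ {v} {w} vx≡1 w∑≡1 x<∑) , m , λ i m≤i →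
        subst (recipℚ (∑1/i! i) + (v - w) ≤_)
          (solve 2 (λ v w → w :+ (v :- w) := v) refl v w)
          (+-monoˡ-≤ (v - w) (inverse-antimono-≤ 0<∑ (0<∑i m≤i) {w} {recipℚ (∑1/i! i)} w∑≡1
            (recipℚ-inverseˡ (0<∑i m≤i)) (∑1/i!-mono (ℕ.≤⇒≤′ m≤i))))

  <-≤-transℝ : ∀ {x y z} → x ℝ.< y → y ℝ.≤ z → x ℝ.< z
  <-≤-transℝ {x} {y} {z} (ε , 0<ε , N , x+ε≤y) y≤z =
    let M , y≤z+½ε = y≤z (½ * ε) 0<½ε
    in ½ * ε , 0<½ε , N ℕ.⊔ M , λ m N⊔M≤m →
      excess ((seq y m - (seq x m + ε)) + (seq z m + ½ * ε - seq y m))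
        (+-nonneg (p≤q⇒0≤q-p (x+ε≤y m (ℕ.m⊔n≤o⇒m≤o N M N⊔M≤m)))
          (p≤q⇒0≤q-p (y≤z+½ε m (ℕ.m⊔n≤o⇒n≤o N M N⊔M≤m))))
        (solve 4 (λ x y z ε → z := x :+ con ½ :* ε :+
          ((y :- (x :+ ε)) :+ (z :+ con ½ :* ε :- y))) refl (seq x m) (seq y m) (seq z m) ε)
    where
    0<½ε : 0ℚ < ½ * ε
    0<½ε = *-pos (positive⁻¹ ½) 0<ε

  -- The rational `v = 1 / (1 + 1 / k) ^ k` separates the two sides. Strictness comes from its
  -- comparison with `1/e`, so the limit argument for `μ` need only give a weak inequality.
  1/e<μ : ∀ k .{{_ : NonZero k}} {𝒜 : Pred (Subset n) ℓ} (𝒜? : Decidable 𝒜) → Monotone 𝒜 →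
    (∀ {A} → IsMinterm 𝒜 A → ∣ A ∣ ℕ.≤ k) →
    ∀ p → 0ℝ ℝ.≤ p → fromℕ k ℝ.* p ℝ.≤ 1ℝ → Is𝔼* p 𝒜 1ℝ →
    1/e ℝ.< μ (fromℕ k ℝ.* p) 𝒜?
  1/e<μ k {𝒜 = 𝒜} 𝒜? mono minterms≤k p 0≤p kp≤1 𝔼*≡1 = from-h (inverse (0<ι k))
    where
    from-h : ∃[ h ] (0ℚ < h × h * ι k ≡ 1ℚ) → 1/e ℝ.< μ (fromℕ k ℝ.* p) 𝒜?
    from-h (h , 0<h , hk≡1) = from-v (inverse 0<c)
      where
      c : ℚ
      c = (1ℚ + h) ^ k
      0<c : 0ℚ < c
      0<c = <-≤-trans (positive⁻¹ 1ℚ) (1≤x^m (1≤1+nonneg (<⇒≤ 0<h)) k)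
      c<∑ : c < ∑1/i! (suc k)
      c<∑ = 1+1/k^k<∑1/i! k (<⇒≤ 0<h) (trans (*-comm (ι k) h) hk≡1)
      from-v : ∃[ v ] (0ℚ < v × v * c ≡ 1ℚ) → 1/e ℝ.< μ (fromℕ k ℝ.* p) 𝒜?
      from-v (v , 0<v , vc≡1) = <-≤-transℝ {1/e} {fromℚ v} {μ (fromℕ k ℝ.* p) 𝒜?}
        (1/e<rational (suc k) 0<c vc≡1 c<∑)
        (measure-≥ k 𝒜? mono minterms≤k p 0≤p kp≤1 𝔼*≡1 (<⇒≤ 0<h) hk≡1 0<v vc≡1)

open import Defs

corollary2p5 :
  ∀ (k : ℕ) .{{_ : NonZero k}} (n : ℕ) {ℓ}
  {𝒜 : Pred (Subset (suc n)) ℓ} (𝒜? : Decidable 𝒜) →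
  Monotone 𝒜 →
  (∀ {A} → IsMinterm 𝒜 A → ∣ A ∣ ℕ.≤ k) →
  (p : ℝ) → 0ℝ ≤ p → p ≤ 1ℝ → fromℕ k * p ≤ 1ℝ →
  Is𝔼* p 𝒜 1ℝ →
  1/e < μ (fromℕ k * p) 𝒜?
corollary2p5 k n 𝒜? monotone minterms≤k p 0≤p _ kp≤1 𝔼*≡1 =
  SecondMomentMethod.1/e<μ k 𝒜? monotone minterms≤k p 0≤p kp≤1 𝔼*≡1
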